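{- Let $\mathcal C$ be a semi-value configuration of the main calculus that is well-formed with type $A$. Then there is no infinite sequence of reductions $$\mathcal C\leadsto_{p_0}\mathcal C_1\leadsto_{p_1}\mathcal C_2\leadsto_{p_2}\cdots .$$
   Context: **PURE QUANTUM LANGUAGE.** **Syntax.** Ground quantum types: $Q::=I\mid Q\oplus Q\mid Q\otimes Q\mid\mathrm{qnat}$, with $\mathrm{qbit}:=I\oplus I$. Unitary types: $U(Q_1,Q_2)$. Let $x$ range over variables and $\alpha$ over complex scalars; all index sets are finite. Basis values: $b::=*\mid x\mid\mathrm{inl}\,b\mid\mathrm{inr}\,b\mid b\otimes b\mid 0\mid S\,b$ (a total order on them is fixed). Quantum values: $v::=\sum_{i\in I}(\alpha_i\cdot b_i)$ with the $b_i$ in increasing order and all $\alpha_i\neq 0$. Expressions: $e::=*\mid x\mid\mathrm{inl}\,e\mid\mathrm{inr}\,e\mid e\otimes e\mid 0\mid S\,e\mid\sum_{i\in I}(\alpha_i\cdot e_i)$. Unitaries: $u::=\{b_1\mapsto e_1\mid\dots\mid b_n\mapsto e_n\}\mid u\otimes u\mid u\oplus u\mid u\circ u\mid u^*\mid\mathrm{ctrl}\,u$. Quantum terms: $t::=*\mid x\mid\mathrm{inl}\,t\mid\mathrm{inr}\,t\mid t\otimes t\mid 0\mid S\,t\mid u\,t\mid\sum_{i\in I}(\alpha_i\cdot t_i)$. **Orthogonality** $\perp$ is the smallest symmetric relation on quantum terms such that: $\mathrm{inl}\,t_1\perp\mathrm{inr}\,t_2$; $0\perp S\,t$; if $t_1\perp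 t_2$ then $S\,t_1\perp S\,t_2$, $\mathrm{inl}\,t_1\perp\mathrm{inl}\,t_2$, $\mathrm{inr}\,t_1\perp\mathrm{inr}\,t_2$, $u\,t_1\perp u\,t_2$, and, for all $t,t'$, $t\otimes t_1\perp t'\otimes t_2$ and $t_1\otimes t\perp t_2\otimes t'$; if $t\perp t_i$ for all $i\in I$ then $t\perp\sum_{i\in I}(\alpha_i\cdot t_i)$; if $t\perp t_i$ for all $i\in I$, $\alpha_\star=0$ and $t_\star=t$, then $t\perp\sum_{i\in I\cup\{\star\}}(\alpha_i\cdot t_i)$; if $t_i\perp t_j$ for all $i\ne j\in I$, $J,K\subseteq I$ and $\sum_{i\in J\cap K}\overline{\alpha_i}\beta_i=0$, then $\sum_{j\in J}(\alpha_j\cdot t_j)\perp\sum_{k\in K}(\beta_k\cdot t_k)$. **Orthonormal bases.** For a set $S$ of elements of the form $b\otimes b'$, $\pi_1(S),\pi_2(S)$ are the sets of first, resp. second, components, $S^1_b=\{b'\mid b\otimes b'\in S\}$ and $S^2_b=\{b'\mid b'\otimes b\in S\}$. $\mathrm{ONB}_Q$ is the smallest predicate on finite sets of basis values with: $\mathrm{ONB}_Q(\{x\})$; $\mathrm{ONB}_I(\{*\})$; if $\mathrm{ONB}_{Q_1}(S)$ and $\mathrm{ONB}_{Q_2}(T)$ then $\mathrm{ONB}_{Q_1\oplus Q_2}(\{\mathrm{inl}\,b\mid b\in S\}\cup\{\mathrm{inr}\,b\mid b\in T\})$; if $\mathrm{ONB}_{\mathrm{qnat}}(S)$ then $\mathrm{ONB}_{\mathrm{qnat}}(\{0\}\cup\{S\,b\mid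 b\in S\})$; $\mathrm{ONB}_{Q_1\otimes Q_2}(S)$ if $\mathrm{ONB}_{Q_2}(\pi_2(S))$ and $\mathrm{ONB}_{Q_1}(S^2_b)$ for all $b\in\pi_2(S)$; $\mathrm{ONB}_{Q_1\otimes Q_2}(S)$ if $\mathrm{ONB}_{Q_1}(\pi_1(S))$ and $\mathrm{ONB}_{Q_2}(S^1_b)$ for all $b\in\pi_1(S)$. $\mathrm{ONB}^e_Q$ is the predicate on finite sets of expressions generated by the same rules (for expressions) together with: if $\mathrm{ONB}^e_Q(S)$ and $(\alpha_{e,e'})_{(e,e')\in S\times S}$ is a unitary matrix then $\mathrm{ONB}^e_Q(\{\sum_{e'\in S}(\alpha_{e,e'}\cdot e')\mid e\in S\})$. **Pure typing** (contexts $\Gamma$ are finite sets of pairs $x:Q$, used strictly linearly). $\vdash *:I$; $x:Q\vdash x:Q$; $\Gamma_1,\Gamma_2\vdash t_1\otimes t_2:Q_1\otimes Q_2$ if $\Gamma_i\vdash t_i:Q_i$; $\Gamma\vdash\mathrm{inl}\,t:Q_1\oplus Q_2$ if $\Gamma\vdash t:Q_1$; $\Gamma\vdash\mathrm{inr}\,t:Q_1\oplus Q_2$ if $\Gamma\vdash t:Q_2$; $\vdash 0:\mathrm{qnat}$; $\Gamma\vdash S\,t:\mathrm{qnat}$ if $\Gamma\vdash t:\mathrm{qnat}$; $\Gamma\vdash\sum_i(\alpha_i\cdot t_i):Q$ if $\Gamma\vdash t_i:Q$ for all $i$, $\sum_i|\alpha_i|^2=1$ and $t_i\perp t_j$ for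 $i\neq j$; $\Gamma\vdash u\,t:Q_2$ if $\Vdash u:U(Q_1,Q_2)$ and $\Gamma\vdash t:Q_1$. Unitaries: $\Vdash\{b_1\mapsto e_1\mid\dots\mid b_n\mapsto e_n\}:U(Q_1,Q_2)$ if there are $\Gamma_i$ with $\Gamma_i\vdash b_i:Q_1$, $\Gamma_i\vdash e_i:Q_2$, $\mathrm{ONB}_{Q_1}(\{b_1,\dots,b_n\})$ and $\mathrm{ONB}^e_{Q_2}(\{e_1,\dots,e_n\})$ (the $b_i$ pairwise distinct, the $e_i$ pairwise distinct); $u^*:U(Q_2,Q_1)$ if $u:U(Q_1,Q_2)$; $u_2\circ u_1:U(Q_1,Q_3)$ if $u_1:U(Q_1,Q_2)$, $u_2:U(Q_2,Q_3)$; $u_1\otimes u_2:U(Q_1\otimes Q_3,Q_2\otimes Q_4)$ and $u_1\oplus u_2:U(Q_1\oplus Q_3,Q_2\oplus Q_4)$ if $u_1:U(Q_1,Q_2)$, $u_2:U(Q_3,Q_4)$; $\mathrm{ctrl}\,u:U(\mathrm{qbit}\otimes Q,\mathrm{qbit}\otimes Q)$ if $u:U(Q,Q)$. **Matching.** A valuation $\sigma$ is a finite partial map from variables to expressions; $\sigma(t)$ denotes substitution. $\mathrm{match}(\emptyset,*,*)$; $\mathrm{match}(\{x\mapsto b'\},x,b')$; $\mathrm{match}(\emptyset,0,0)$; $\mathrm{match}(\sigma,b,b')$ implies $\mathrm{match}(\sigma,\mathrm{inl}\,b,\mathrm{inl}\,b')$, $\mathrm{match}(\sigma,\mathrm{inr}\,b,\mathrm{inr}\,b')$,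 $\mathrm{match}(\sigma,S\,b,S\,b')$; $\mathrm{match}(\sigma_1,b_1,b_1')$, $\mathrm{match}(\sigma_2,b_2,b_2')$ with disjoint supports imply $\mathrm{match}(\sigma_1\cup\sigma_2,b_1\otimes b_2,b_1'\otimes b_2')$. **Pure equational theory.** $\Gamma\vdash t_1=t_2:Q$ is generated by reflexivity (for well-formed terms), symmetry, transitivity and: (linear algebra, left-hand sides or displayed components well-formed) permuting the summands of a sum; deleting a summand with scalar $0$; $\sum_{i=1}^1(1\cdot t)=t$; $\sum_i(\alpha_i\cdot\sum_j(\beta_{ij}\cdot t_j))=\sum_j((\sum_i\alpha_i\beta_{ij})\cdot t_j)$; $\sum_i(\alpha_i\cdot\sum_j(\beta_{ij}\cdot t_{ij}))=\sum_{ij}(\alpha_i\beta_{ij}\cdot t_{ij})$ provided the right-hand side is well-formed; $C[\sum_i(\alpha_i\cdot t_i)]=\sum_i(\alpha_i\cdot C[t_i])$ for $C[-]$ one of $u\,-$, $\mathrm{inl}\,-$, $\mathrm{inr}\,-$, $S\,-$, $t\otimes-$, $-\otimes t$; (congruence) from $t_1=t_2$ infer $C[t_1]=C[t_2]$ for the same $C$, and from $\Gamma\vdash\sum_i(\alpha_i\cdot t_i):Q$ and $t_i=t_i'$ for all $i$ infer $\sum_i(\alpha_i\cdot t_i)=\sum_i(\alpha_i\cdot t_i')$; (computation, $b$'s basis values, closed except in the rule for $\circ$, $v$ a value) $\{b_1\mapsto e_1\mid\dots\mid b_n\mapsto e_n\}\,b'=\sigma(e_i)$ if $\mathrm{match}(\sigma,b_i,b')$;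 from $u\,b=v$ infer $u^*\,v=b$; $(u_2\circ u_1)\,b=u_2\,(u_1\,b)$; $(u_1\otimes u_2)(b_1\otimes b_2)=(u_1\,b_1)\otimes(u_2\,b_2)$; $(u_1\oplus u_2)(\mathrm{inl}\,b)=\mathrm{inl}\,(u_1\,b)$; $(u_1\oplus u_2)(\mathrm{inr}\,b)=\mathrm{inr}\,(u_2\,b)$; $(\mathrm{ctrl}\,u)((\mathrm{inl}\,*)\otimes b)=(\mathrm{inl}\,*)\otimes b$; $(\mathrm{ctrl}\,u)((\mathrm{inr}\,*)\otimes b)=(\mathrm{inr}\,*)\otimes(u\,b)$. **MAIN CALCULUS.** **Types and terms.** Types: $A,B::=I\mid A+B\mid A\otimes B\mid{!A}\mid A\multimap B\mid\mathrm{Nat}\mid\mathcal B(Q)$. Terms: $L,M,N::=*\mid x\mid\mathit{inl}(M)\mid\mathit{inr}(M)\mid\mathit{case}\,L\,\mathit{of}\,\{\mathit{inl}(x)\to M,\mathit{inr}(y)\to N\}\mid M\otimes N\mid\mathit{let}\,x\otimes y=M\,\mathit{in}\,N\mid\mathit{lift}(M)\mid\mathit{force}(M)\mid\lambda x.M\mid M\,N\mid\mathit{zero}\mid\mathit{succ}(M)\mid\mathit{match}\,L\,\mathit{with}\,\{\mathit{zero}\to M,\mathit{succ}(x)\to N\}\mid\mathit{pure}(t)\mid\mathit{meas}(M)\mid\mathcal B(u)(M)\mid\mathit{let}\,\mathcal B(z)=M\,\mathit{in}\,N\mid\mathit{let}\,\mathcal B(x\otimes y)=M\,\mathit{in}\,N$.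 Values: $V,W::=*\mid x\mid\mathit{inl}(V)\mid\mathit{inr}(V)\mid V\otimes W\mid\mathit{lift}(M)\mid\lambda x.M\mid\mathit{zero}\mid\mathit{succ}(V)$. Classical analogues: $\overline I=I$, $\overline{Q_1\otimes Q_2}=\overline{Q_1}\otimes\overline{Q_2}$, $\overline{Q_1\oplus Q_2}=\overline{Q_1}+\overline{Q_2}$, $\overline{\mathrm{qnat}}=\mathrm{Nat}$; $\overline*=*$, $\overline{b_1\otimes b_2}=\overline{b_1}\otimes\overline{b_2}$, $\overline{\mathrm{inl}\,b}=\mathit{inl}(\overline b)$, $\overline{\mathrm{inr}\,b}=\mathit{inr}(\overline b)$, $\overline0=\mathit{zero}$, $\overline{S\,b}=\mathit{succ}(\overline b)$. **Typing.** Contexts $\Delta,\Sigma$ are finite sequences $x_1:A_1,\dots,x_n:A_n$ (exchange allowed); $!\Delta$ denotes a context all of whose types are of the form $!A$; comma is disjoint union. $!\Delta\vdash*:I$; $!\Delta,x:A\vdash x:A$; $\mathit{inl}(M):A+B$ if $M:A$ and $\mathit{inr}(M):A+B$ if $M:B$ (same context); $!\Delta,\Sigma_1,\Sigma_2\vdash\mathit{case}\,L\,\mathit{of}\,\{\dots\}:C$ if $!\Delta,\Sigma_1\vdash L:A+B$, $!\Delta,\Sigma_2,x:A\vdash M:C$, $!\Delta,\Sigma_2,y:B\vdash N:C$; $!\Delta,\Sigma_1,\Sigma_2\vdash M\otimes N:A\otimes B$ if $!\Delta,\Sigma_1\vdash M:A$, $!\Delta,\Sigma_2\vdash N:B$;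 $!\Delta,\Sigma_1,\Sigma_2\vdash\mathit{let}\,x\otimes y=M\,\mathit{in}\,N:C$ if $!\Delta,\Sigma_1\vdash M:A\otimes B$, $!\Delta,\Sigma_2,x:A,y:B\vdash N:C$; $!\Delta\vdash\mathit{lift}(M):{!A}$ if $!\Delta\vdash M:A$; $\Delta\vdash\mathit{force}(M):A$ if $\Delta\vdash M:{!A}$; $\Delta\vdash\lambda x.M:A\multimap B$ if $\Delta,x:A\vdash M:B$; $!\Delta,\Sigma_1,\Sigma_2\vdash M\,N:B$ if $!\Delta,\Sigma_1\vdash M:A\multimap B$, $!\Delta,\Sigma_2\vdash N:A$; $!\Delta\vdash\mathit{zero}:\mathrm{Nat}$; $\Delta\vdash\mathit{succ}(M):\mathrm{Nat}$ if $\Delta\vdash M:\mathrm{Nat}$; $!\Delta,\Sigma_1,\Sigma_2\vdash\mathit{match}\,L\,\mathit{with}\,\{\dots\}:A$ if $!\Delta,\Sigma_1\vdash L:\mathrm{Nat}$, $!\Delta,\Sigma_2\vdash M:A$, $!\Delta,\Sigma_2,x:\mathrm{Nat}\vdash N:A$; $!\Delta\vdash\mathit{pure}(t):\mathcal B(Q)$ if $\cdot\vdash t:Q$ in the pure language; $\Delta\vdash\mathit{meas}(M):\overline Q$ if $\Delta\vdash M:\mathcal B(Q)$; $\Delta\vdash\mathcal B(u)(M):\mathcal B(Q_2)$ if $\Vdash u:U(Q_1,Q_2)$, $\Delta\vdash M:\mathcal B(Q_1)$; $!\Delta,\Sigma_1,\Sigma_2\vdash\mathit{let}\,\mathcal B(z)=M\,\mathit{in}\,N:A$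 if $!\Delta,\Sigma_1\vdash M:\mathcal B(Q_1)\otimes\mathcal B(Q_2)$, $!\Delta,\Sigma_2,z:\mathcal B(Q_1\otimes Q_2)\vdash N:A$; $!\Delta,\Sigma_1,\Sigma_2\vdash\mathit{let}\,\mathcal B(x\otimes y)=M\,\mathit{in}\,N:A$ if $!\Delta,\Sigma_1\vdash M:\mathcal B(Q_1\otimes Q_2)$, $!\Delta,\Sigma_2,x:\mathcal B(Q_1),y:\mathcal B(Q_2)\vdash N:A$. **Configurations.** A quantum configuration is a triple $(t,u_\sigma,M)$ with $t$ a quantum term, $u_\sigma$ a unitary representing a canonical symmetric monoidal isomorphism (built from unitors, associators, symmetries, $\circ$, $\otimes$; below called a permutation), and $M$ a main-calculus term. It is a value configuration if $t$ is a quantum value and $M$ a value; a semi-value configuration if $t$ is a quantum value. It is well-formed with type $A$ if $\cdot\vdash t:Q_1\otimes\cdots\otimes Q_n$, $\Vdash u_\sigma:U(Q_1\otimes\cdots\otimes Q_n,Q_1'\otimes\cdots\otimes Q_m')$ and $x_1:\mathcal B(Q_1'),\dots,x_m:\mathcal B(Q_m')\vdash M:A$, the variables $x_1,\dots,x_m$ being listed in the order in which they occur in $M$, so that $x_i$ represents the $i$-th block of $u_\sigma t$ (an empty tensor is $I$, with term $*$). More generally one allows auxiliary quantum data: $u_\sigma$ has target $Q_1'\otimes\cdots\otimes Q_m'\otimes Q_1''\otimes\cdots\otimes Q_k''$, where only the first $m$ blocks are represented by variables. Configurations are taken up to renaming of variables, and permutations are identified when they denote the same isomorphism. **Evaluation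 contexts.** $E::=[\cdot]\mid E\otimes N\mid V\otimes E\mid\mathit{let}\,x\otimes y=E\,\mathit{in}\,N\mid\mathit{inl}(E)\mid\mathit{inr}(E)\mid\mathit{case}\,E\,\mathit{of}\,\{\dots\}\mid\mathit{force}(E)\mid\mathit{succ}(E)\mid\mathit{match}\,E\,\mathit{with}\,\{\dots\}\mid E\,N\mid V\,E\mid\mathit{meas}(E)\mid\mathcal B(u)(E)\mid\mathit{let}\,\mathcal B(z)=E\,\mathit{in}\,N\mid\mathit{let}\,\mathcal B(x\otimes y)=E\,\mathit{in}\,N$. **Small-step rules** $\to_p$ on configurations. The following leave $t,u_\sigma$ unchanged and have $p=1$: $\mathit{case}\,\mathit{inl}(V)\,\mathit{of}\{\mathit{inl}(x)\to M,\mathit{inr}(y)\to N\}\to M[V/x]$, and with $\mathit{inr}(V)$: $\to N[V/y]$; $\mathit{let}\,x\otimes y=V\otimes W\,\mathit{in}\,M\to M[V/x,W/y]$; $\mathit{force}(\mathit{lift}(M))\to M$; $(\lambda x.M)V\to M[V/x]$; $\mathit{match}\,\mathit{zero}\,\mathit{with}\{\mathit{zero}\to M,\mathit{succ}(x)\to N\}\to M$, and with $\mathit{succ}(V)$: $\to N[V/x]$. Further: $(t,u_\sigma,\mathit{pure}(t'))\to_1(t\otimes t',u_{\mathrm{swap}}\circ(u_\sigma\otimes u_{id}),x)$ with $u_{\mathrm{swap}}=\{x\otimes y\mapsto y\otimes x\}$; $(\sum_ip_i\cdot\sum_j\alpha_{ij}\cdot b'_{ij}\otimes\cdots\otimes b_i\otimes\cdots\otimes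 b''_{ij},u_{\sigma_s},\mathit{meas}(x))\to_{|p_k|^2}(\sum_j\alpha_{kj}\cdot b'_{kj}\otimes\cdots\otimes b''_{kj},u_{id},\overline{b_k})$ for each $k$, where $b_i$ is in the tensor position $s$ to which $x$ is linked, the $b_i$ are pairwise distinct, $p_i>0$, and $u_{\sigma_s}$ moves position $s$ to the front; $(t,u_\sigma,\mathcal B(u)(z))\to_1((u_\sigma^*\circ(u\otimes id)\circ u_\sigma)\,t,u_\sigma,z)$; $(t,u_\sigma,\mathit{let}\,\mathcal B(z)=x\otimes y\,\mathit{in}\,N)\to_1(t,u_{\mathrm{gather}}\circ u_\sigma,N)$, where $u_{\mathrm{gather}}$ merges the adjacent blocks of $x$ and $y$ into one block, represented by $z$; $(t,u_\sigma,\mathit{let}\,\mathcal B(x\otimes y)=z\,\mathit{in}\,N)\to_1(t,u_{\mathrm{divide}}\circ u_\sigma,N)$, where $u_{\mathrm{divide}}$ splits the block of $z$ into two blocks, represented by $x$ and $y$; contextual rule: if $(t_1,u_{\sigma_1^{ext}},M_1)\to_p(t_2,u_{\sigma_2^{ext}},M_2)$ and $\mathrm{dom}(\sigma)\cap(\mathrm{dom}(\sigma_1)\cup\mathrm{dom}(\sigma_2))=\emptyset$, then $(t_1,u_{\sigma^{ext}\circ\sigma_1^{ext}},E[M_1])\to_p(t_2,u_{\sigma^{ext}\circ\sigma_2^{ext}},E[M_2])$. Here $\sigma^{ext}$ extends a permutation by the identity on additional indices; in the premise the components represented by variables of $E$ are auxiliary, and in the conclusion they stay linked to the same variables. **Reduction**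 $\leadsto_p$ on semi-value configurations: $(v,u_\sigma,M)\leadsto_p(v',u_{\sigma'},M')$ iff there are quantum terms $t,t'$ with $\cdot\vdash v=t:Q$, $(t,u_\sigma,M)\to_p(t',u_{\sigma'},M')$ and $\cdot\vdash t'=v':Q'$, where $v,v'$ are quantum values. -}

module Defs where

open import Level using (0ℓ)
open import Algebra.Bundles using (AbelianGroup)
open import Algebra.Properties.CommutativeSemigroup using (interchange)
open import Data.Fin.Base as Fin using (Fin; zero; suc; _↑ˡ_; _↑ʳ_)
import Data.Fin.Properties as Fin
open import Data.Fin.Permutation using (Permutation′; _⟨$⟩ʳ_)
open import Data.List.Base as List using (List; []; _∷_)
open import Data.List.Relation.Binary.Disjoint.Propositional using (Disjoint)
open import Data.List.Relation.Binary.Permutation.Propositional using (_↭_)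
open import Data.List.Relation.Unary.Any using (Any)
open import Data.Maybe.Base as Maybe using (Maybe; just; nothing)
open import Data.Nat.Base as ℕ using (ℕ; zero; suc)
import Data.Nat.Properties as ℕ
open import Data.Product.Base using (Σ; Σ-syntax; ∃; _×_; _,_; proj₁; proj₂; uncurry)
open import Data.Rational.Base as ℚ using (ℚ; 0ℚ; 1ℚ; ½)
import Data.Rational.Properties as ℚ
open import Data.Sum.Base using (_⊎_)
open import Data.Unit.Base using (⊤; tt)
open import Data.Vec.Base as Vec using (Vec; []; _∷_)
open import Data.Vec.Functional using (Vector; foldr; removeAt)
open import Data.Vec.Relation.Unary.All using (All)
open import Function.Bundles using (_⇔_; _↔_; Inverse)
open import Relation.Binary.Construct.Closure.Equivalence using (EqClosure)
open import Relation.Binary.Core using (Rel)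
open import Relation.Binary.PropositionalEquality using (_≡_; _≢_; refl; sym; trans; cong; cong₂; subst; module ≡-Reasoning)
open import Relation.Nullary.Decidable using (does)
open import Relation.Nullary.Negation using (¬_)
open import Data.Bool.Base using (if_then_else_; _∧_)

Cauchy : (ℕ → ℚ) → Set
Cauchy s = ∀ ε → 0ℚ ℚ.< ε → ∃ λ N → ∀ m n → N ℕ.≤ m → N ℕ.≤ n → ℚ.∣ s m ℚ.- s n ∣ ℚ.< ε

-- A real number is represented by a Cauchy sequence of rationals; two
-- representatives of the same real are related by _≈ᴿ_.
record ℝ : Set where
  constructor real
  field
    seq    : ℕ → ℚ
    cauchy : Cauchy seq

open ℝ

infix 4 _≈ᴿ_
_≈ᴿ_ : ℝ → ℝ → Set
x ≈ᴿ y = ∀ ε → 0ℚ ℚ.< ε → ∃ λ N → ∀ n → N ℕ.≤ n → ℚ.∣ seq x n ℚ.- seq y n ∣ ℚ.< ε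

Positiveᴿ : ℝ → Set
Positiveᴿ x = ∃ λ ε → 0ℚ ℚ.< ε × ∃ λ N → ∀ n → N ℕ.≤ n → ε ℚ.< seq x n

private
  l1 : ∀ a b c d → (a ℚ.+ b) ℚ.- (c ℚ.+ d) ≡ (a ℚ.- c) ℚ.+ (b ℚ.- d)
  l1 a b c d = trans (cong ((a ℚ.+ b) ℚ.+_) (ℚ.neg-distrib-+ c d))
    (interchange (AbelianGroup.commutativeSemigroup ℚ.+-0-abelianGroup) a b (ℚ.- c) (ℚ.- d))

  l2 : ∀ e → ½ ℚ.* e ℚ.+ ½ ℚ.* e ≡ e
  l2 e = trans (sym (ℚ.*-distribʳ-+ e ½ ½)) (ℚ.*-identityˡ e)

  l3 : ∀ a b → a ≡ (a ℚ.- b) ℚ.+ b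
  l3 a b = sym (trans (ℚ.+-assoc a (ℚ.- b) b)
    (trans (cong (a ℚ.+_) (ℚ.+-inverseˡ b)) (ℚ.+-identityʳ a)))

  l4 : ∀ a b c d → (a ℚ.* b) ℚ.- (c ℚ.* d) ≡ a ℚ.* (b ℚ.- d) ℚ.+ d ℚ.* (a ℚ.- c)
  l4 a b c d = begin
    (a ℚ.* b) ℚ.- (c ℚ.* d)
      ≡⟨ cong (λ z → a ℚ.* b ℚ.- z) (ℚ.*-comm c d) ⟩
    (a ℚ.* b) ℚ.- (d ℚ.* c)
      ≡⟨ cong (ℚ._- d ℚ.* c) (l3 (a ℚ.* b) (a ℚ.* d)) ⟩
    ((a ℚ.* b ℚ.- a ℚ.* d) ℚ.+ a ℚ.* d) ℚ.- d ℚ.* c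
      ≡⟨ ℚ.+-assoc (a ℚ.* b ℚ.- a ℚ.* d) (a ℚ.* d) _ ⟩
    (a ℚ.* b ℚ.- a ℚ.* d) ℚ.+ (a ℚ.* d ℚ.- d ℚ.* c)
      ≡⟨ cong₂ ℚ._+_ (dist a b d) (trans (cong (ℚ._- d ℚ.* c) (ℚ.*-comm a d)) (dist d a c)) ⟩
    a ℚ.* (b ℚ.- d) ℚ.+ d ℚ.* (a ℚ.- c) ∎
    where
    open ≡-Reasoning
    dist : ∀ x y z → x ℚ.* y ℚ.- x ℚ.* z ≡ x ℚ.* (y ℚ.- z)
    dist x y z = trans (cong (x ℚ.* y ℚ.+_) (ℚ.neg-distribʳ-* x z)) (sym (ℚ.*-distribˡ-+ x y (ℚ.- z)))

  l5 : ∀ b c i e → b ℚ.* (i ℚ.* e) ℚ.+ c ℚ.* (i ℚ.* e) ≡ ((b ℚ.+ c) ℚ.* i) ℚ.* e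
  l5 b c i e = trans (sym (ℚ.*-distribʳ-+ (i ℚ.* e) b c)) (sym (ℚ.*-assoc (b ℚ.+ c) i e))

  const-cauchy₀ : ∀ q → Cauchy (λ _ → q)
  const-cauchy₀ q ε 0<ε = 0 , λ _ _ _ _ → subst (ℚ._< ε) (sym (cong ℚ.∣_∣ (ℚ.+-inverseʳ q))) 0<ε

  +-cauchy₀ : ∀ s t → Cauchy s → Cauchy t → Cauchy (λ n → s n ℚ.+ t n)
  +-cauchy₀ s t cs ct ε 0<ε = N , bound
    where
    open ℚ.≤-Reasoning
    δ = ½ ℚ.* ε
    0<δ : 0ℚ ℚ.< δ
    0<δ = subst (ℚ._< δ) (ℚ.*-zeroʳ ½) (ℚ.*-monoʳ-<-pos ½ 0<ε)
    N₁ = proj₁ (cs δ 0<δ)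
    N₂ = proj₁ (ct δ 0<δ)
    N = N₁ ℕ.⊔ N₂
    bound : ∀ m n → N ℕ.≤ m → N ℕ.≤ n → ℚ.∣ (s m ℚ.+ t m) ℚ.- (s n ℚ.+ t n) ∣ ℚ.< ε
    bound m n N≤m N≤n = begin-strict
      ℚ.∣ (s m ℚ.+ t m) ℚ.- (s n ℚ.+ t n) ∣
        ≡⟨ cong ℚ.∣_∣ (l1 (s m) (t m) (s n) (t n)) ⟩
      ℚ.∣ (s m ℚ.- s n) ℚ.+ (t m ℚ.- t n) ∣
        ≤⟨ ℚ.∣p+q∣≤∣p∣+∣q∣ (s m ℚ.- s n) (t m ℚ.- t n) ⟩
      ℚ.∣ s m ℚ.- s n ∣ ℚ.+ ℚ.∣ t m ℚ.- t n ∣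
        <⟨ ℚ.+-mono-< (proj₂ (cs δ 0<δ) m n (ℕ.m⊔n≤o⇒m≤o N₁ N₂ N≤m) (ℕ.m⊔n≤o⇒m≤o N₁ N₂ N≤n))
                      (proj₂ (ct δ 0<δ) m n (ℕ.m⊔n≤o⇒n≤o N₁ N₂ N≤m) (ℕ.m⊔n≤o⇒n≤o N₁ N₂ N≤n)) ⟩
      δ ℚ.+ δ
        ≡⟨ l2 ε ⟩
      ε ∎

  neg-cauchy₀ : ∀ s → Cauchy s → Cauchy (λ n → ℚ.- s n)
  neg-cauchy₀ s cs ε 0<ε = proj₁ (cs ε 0<ε) , λ m n N≤m N≤n →
    subst (ℚ._< ε)
      (trans (sym (ℚ.∣-p∣≡∣p∣ (s m ℚ.- s n))) (cong ℚ.∣_∣ (ℚ.neg-distrib-+ (s m) (ℚ.- s n))))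
      (proj₂ (cs ε 0<ε) m n N≤m N≤n)

  bounded : ∀ s → Cauchy s → ∃ λ B → ℚ.Positive B × ∃ λ N → ∀ n → N ℕ.≤ n → ℚ.∣ s n ∣ ℚ.≤ B
  bounded s cs = B , ℚ.positive 0<B , N , bound
    where
    open ℚ.≤-Reasoning
    0<1 : 0ℚ ℚ.< 1ℚ
    0<1 = ℚ.positive⁻¹ 1ℚ
    N = proj₁ (cs 1ℚ 0<1)
    B = 1ℚ ℚ.+ ℚ.∣ s N ∣
    0<B : 0ℚ ℚ.< B
    0<B = ℚ.+-mono-<-≤ 0<1 (ℚ.0≤∣p∣ (s N))
    bound : ∀ n → N ℕ.≤ n → ℚ.∣ s n ∣ ℚ.≤ B
    bound n N≤n = begin
      ℚ.∣ s n ∣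
        ≡⟨ cong ℚ.∣_∣ (l3 (s n) (s N)) ⟩
      ℚ.∣ (s n ℚ.- s N) ℚ.+ s N ∣
        ≤⟨ ℚ.∣p+q∣≤∣p∣+∣q∣ (s n ℚ.- s N) (s N) ⟩
      ℚ.∣ s n ℚ.- s N ∣ ℚ.+ ℚ.∣ s N ∣
        ≤⟨ ℚ.+-monoˡ-≤ ℚ.∣ s N ∣ (ℚ.<⇒≤ (proj₂ (cs 1ℚ 0<1) n N N≤n ℕ.≤-refl)) ⟩
      B ∎

  *-cauchy₀ : ∀ s t → Cauchy s → Cauchy t → Cauchy (λ n → s n ℚ.* t n)
  *-cauchy₀ s t cs ct ε 0<ε with bounded s cs | bounded t ct
  ... | B , B>0 , M₁ , s≤B | C , C>0 , M₂ , t≤C = N , bound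
    where
    open ℚ.≤-Reasoning
    D = B ℚ.+ C
    instance
      B-pos : ℚ.Positive B
      B-pos = B>0
      C-pos : ℚ.Positive C
      C-pos = C>0
      D-pos : ℚ.Positive D
      D-pos = ℚ.pos+pos⇒pos B C
      D≢0 : ℚ.NonZero D
      D≢0 = ℚ.pos⇒nonZero D
      1/D-pos : ℚ.Positive (ℚ.1/ D)
      1/D-pos = ℚ.1/pos⇒pos D
    δ = (ℚ.1/ D) ℚ.* ε
    0<δ : 0ℚ ℚ.< δ
    0<δ = subst (ℚ._< δ) (ℚ.*-zeroʳ (ℚ.1/ D)) (ℚ.*-monoʳ-<-pos (ℚ.1/ D) 0<ε)
    N₁ = proj₁ (cs δ 0<δ)
    N₂ = proj₁ (ct δ 0<δ)
    N = (M₁ ℕ.⊔ M₂) ℕ.⊔ (N₁ ℕ.⊔ N₂)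
    N≥M₁ : ∀ {n} → N ℕ.≤ n → M₁ ℕ.≤ n
    N≥M₁ h = ℕ.m⊔n≤o⇒m≤o M₁ M₂ (ℕ.m⊔n≤o⇒m≤o _ (N₁ ℕ.⊔ N₂) h)
    N≥M₂ : ∀ {n} → N ℕ.≤ n → M₂ ℕ.≤ n
    N≥M₂ h = ℕ.m⊔n≤o⇒n≤o M₁ M₂ (ℕ.m⊔n≤o⇒m≤o _ (N₁ ℕ.⊔ N₂) h)
    N≥N₁ : ∀ {n} → N ℕ.≤ n → N₁ ℕ.≤ n
    N≥N₁ h = ℕ.m⊔n≤o⇒m≤o N₁ N₂ (ℕ.m⊔n≤o⇒n≤o (M₁ ℕ.⊔ M₂) _ h)
    N≥N₂ : ∀ {n} → N ℕ.≤ n → N₂ ℕ.≤ n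
    N≥N₂ h = ℕ.m⊔n≤o⇒n≤o N₁ N₂ (ℕ.m⊔n≤o⇒n≤o (M₁ ℕ.⊔ M₂) _ h)
    half : ∀ A .{{_ : ℚ.Positive A}} x y → ℚ.∣ x ∣ ℚ.≤ A → ℚ.∣ y ∣ ℚ.< δ → ℚ.∣ x ℚ.* y ∣ ℚ.< A ℚ.* δ
    half A x y x≤A y<δ = begin-strict
      ℚ.∣ x ℚ.* y ∣          ≡⟨ ℚ.∣p*q∣≡∣p∣*∣q∣ x y ⟩
      ℚ.∣ x ∣ ℚ.* ℚ.∣ y ∣    ≤⟨ ℚ.*-monoʳ-≤-nonNeg ℚ.∣ y ∣ {{ℚ.∣-∣-nonNeg y}} x≤A ⟩
      A ℚ.* ℚ.∣ y ∣          <⟨ ℚ.*-monoʳ-<-pos A y<δ ⟩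
      A ℚ.* δ ∎
    bound : ∀ m n → N ℕ.≤ m → N ℕ.≤ n → ℚ.∣ (s m ℚ.* t m) ℚ.- (s n ℚ.* t n) ∣ ℚ.< ε
    bound m n N≤m N≤n = begin-strict
      ℚ.∣ (s m ℚ.* t m) ℚ.- (s n ℚ.* t n) ∣
        ≡⟨ cong ℚ.∣_∣ (l4 (s m) (t m) (s n) (t n)) ⟩
      ℚ.∣ (s m ℚ.* (t m ℚ.- t n)) ℚ.+ (t n ℚ.* (s m ℚ.- s n)) ∣
        ≤⟨ ℚ.∣p+q∣≤∣p∣+∣q∣ (s m ℚ.* (t m ℚ.- t n)) (t n ℚ.* (s m ℚ.- s n)) ⟩
      ℚ.∣ s m ℚ.* (t m ℚ.- t n) ∣ ℚ.+ ℚ.∣ t n ℚ.* (s m ℚ.- s n) ∣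
        <⟨ ℚ.+-mono-< (half B (s m) (t m ℚ.- t n) (s≤B m (N≥M₁ N≤m)) (proj₂ (ct δ 0<δ) m n (N≥N₂ N≤m) (N≥N₂ N≤n)))
                      (half C (t n) (s m ℚ.- s n) (t≤C n (N≥M₂ N≤n)) (proj₂ (cs δ 0<δ) m n (N≥N₁ N≤m) (N≥N₁ N≤n))) ⟩
      B ℚ.* δ ℚ.+ C ℚ.* δ
        ≡⟨ l5 B C (ℚ.1/ D) ε ⟩
      (D ℚ.* ℚ.1/ D) ℚ.* ε  ≡⟨ cong (ℚ._* ε) (ℚ.*-inverseʳ D) ⟩
      1ℚ ℚ.* ε               ≡⟨ ℚ.*-identityˡ ε ⟩
      ε ∎

  -- Abstract, so that normalising a statement about reals leaves these alone.
  abstract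
    const-cauchy : ∀ q → Cauchy (λ _ → q)
    const-cauchy = const-cauchy₀

    +-cauchy : ∀ s t → Cauchy s → Cauchy t → Cauchy (λ n → s n ℚ.+ t n)
    +-cauchy = +-cauchy₀

    neg-cauchy : ∀ s → Cauchy s → Cauchy (λ n → ℚ.- s n)
    neg-cauchy = neg-cauchy₀

    *-cauchy : ∀ s t → Cauchy s → Cauchy t → Cauchy (λ n → s n ℚ.* t n)
    *-cauchy = *-cauchy₀

fromℚ : ℚ → ℝ
fromℚ q = real (λ _ → q) (const-cauchy q)

infixl 6 _+ᴿ_
infixl 7 _*ᴿ_
_+ᴿ_ _*ᴿ_ : ℝ → ℝ → ℝ
x +ᴿ y = real (λ n → seq x n ℚ.+ seq y n) (+-cauchy (seq x) (seq y) (cauchy x) (cauchy y))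
x *ᴿ y = real (λ n → seq x n ℚ.* seq y n) (*-cauchy (seq x) (seq y) (cauchy x) (cauchy y))

-ᴿ_ : ℝ → ℝ
-ᴿ x = real (λ n → ℚ.- seq x n) (neg-cauchy (seq x) (cauchy x))

0ᴿ 1ᴿ : ℝ
0ᴿ = fromℚ 0ℚ
1ᴿ = fromℚ 1ℚ

record ℂ : Set where
  constructor _+i_
  field
    re im : ℝ

open ℂ

infix 4 _≈ᶜ_
_≈ᶜ_ : ℂ → ℂ → Set
a ≈ᶜ b = re a ≈ᴿ re b × im a ≈ᴿ im b

ofReal : ℝ → ℂ
ofReal x = x +i 0ᴿ

0ᶜ 1ᶜ : ℂ
0ᶜ = ofReal 0ᴿ
1ᶜ = ofReal 1ᴿ

infixl 6 _+ᶜ_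
infixl 7 _*ᶜ_
_+ᶜ_ _*ᶜ_ : ℂ → ℂ → ℂ
a +ᶜ b = (re a +ᴿ re b) +i (im a +ᴿ im b)
a *ᶜ b = (re a *ᴿ re b +ᴿ -ᴿ (im a *ᴿ im b)) +i (re a *ᴿ im b +ᴿ im a *ᴿ re b)

conj : ℂ → ℂ
conj a = re a +i (-ᴿ im a)

∣_∣² : ℂ → ℝ
∣ a ∣² = re a *ᴿ re a +ᴿ im a *ᴿ im a

Σᴿ : ∀ {n} → (Fin n → ℝ) → ℝ
Σᴿ = foldr _+ᴿ_ 0ᴿ

Σᶜ : ∀ {n} → (Fin n → ℂ) → ℂ
Σᶜ = foldr _+ᶜ_ 0ᶜ

δ : ∀ {n} → Fin n → Fin n → ℂ
δ i j = if does (i Fin.≟ j) then 1ᶜ else 0ᶜ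

IsUnitary : ∀ {n} → (Fin n → Fin n → ℂ) → Set
IsUnitary A =
  (∀ i j → Σᶜ (λ k → A i k *ᶜ conj (A j k)) ≈ᶜ δ i j) ×
  (∀ i j → Σᶜ (λ k → conj (A k i) *ᶜ A k j) ≈ᶜ δ i j)

infixr 6 _⊕_
infixr 7 _⊗_
infixr 9 _⊚_
infixr 8 _·_

data QType : Set where
  I    : QType
  _⊕_  : QType → QType → QType
  _⊗_  : QType → QType → QType
  qnat : QType

qbit : QType
qbit = I ⊕ I

-- Basis values, expressions and quantum terms are successive extensions of
-- one grammar, so they share one datatype indexed by the syntactic class.
data Sort : Set where
  basis expr term : Sort

data HasSums : Sort → Set where
  instance
    expr : HasSums expr
    term : HasSums term

mutual
  -- Finite index sets are of the form Fin n.
  data Tm : Sort → Set where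
    ⋆    : ∀ {k} → Tm k
    var  : ∀ {k} → ℕ → Tm k
    inl  : ∀ {k} → Tm k → Tm k
    inr  : ∀ {k} → Tm k → Tm k
    _⊗_  : ∀ {k} → Tm k → Tm k → Tm k
    zero : ∀ {k} → Tm k
    S    : ∀ {k} → Tm k → Tm k
    sum  : ∀ {k} {{_ : HasSums k}} (n : ℕ) → (Fin n → ℂ) → (Fin n → Tm k) → Tm k
    _·_  : Unitary → Tm term → Tm term

  data Unitary : Set where
    clauses : (n : ℕ) → (Fin n → Tm basis) → (Fin n → Tm expr) → Unitary
    _⊗_ _⊕_ : Unitary → Unitary → Unitary
    _⊚_     : Unitary → Unitary → Unitary
    _†      : Unitary → Unitary
    ctrl    : Unitary → Unitary

⌊_⌋ : ∀ {k} → Tm basis → Tm k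
⌊ ⋆ ⌋      = ⋆
⌊ var x ⌋  = var x
⌊ inl b ⌋  = inl ⌊ b ⌋
⌊ inr b ⌋  = inr ⌊ b ⌋
⌊ b ⊗ c ⌋  = ⌊ b ⌋ ⊗ ⌊ c ⌋
⌊ zero ⌋   = zero
⌊ S b ⌋    = S ⌊ b ⌋

⌈_⌉ : Tm expr → Tm term
⌈ ⋆ ⌉         = ⋆
⌈ var x ⌉     = var x
⌈ inl e ⌉     = inl ⌈ e ⌉
⌈ inr e ⌉     = inr ⌈ e ⌉
⌈ e ⊗ f ⌉     = ⌈ e ⌉ ⊗ ⌈ f ⌉
⌈ zero ⌉      = zero
⌈ S e ⌉       = S ⌈ e ⌉
⌈ sum n α e ⌉ = sum n α (λ i → ⌈ e i ⌉)

infix 4 _≋_ _≋ᵤ_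

-- Syntactic identity.  It differs from _≡_ only in that scalars are compared
-- as complex numbers rather than as representatives, and families pointwise.
mutual
  data _≋_ : ∀ {k} → Tm k → Tm k → Set where
    ⋆    : ∀ {k} → ⋆ {k} ≋ ⋆
    var  : ∀ {k} x → var {k} x ≋ var x
    inl  : ∀ {k} {t t′ : Tm k} → t ≋ t′ → inl t ≋ inl t′
    inr  : ∀ {k} {t t′ : Tm k} → t ≋ t′ → inr t ≋ inr t′
    _⊗_  : ∀ {k} {s s′ t t′ : Tm k} → s ≋ s′ → t ≋ t′ → s ⊗ t ≋ s′ ⊗ t′
    zero : ∀ {k} → zero {k} ≋ zero
    S    : ∀ {k} {t t′ : Tm k} → t ≋ t′ → S t ≋ S t′
    sum  : ∀ {k} {{h : HasSums k}} {n} {α α′ : Fin n → ℂ} {t t′ : Fin n → Tm k} →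
           (∀ i → α i ≈ᶜ α′ i) → (∀ i → t i ≋ t′ i) → sum n α t ≋ sum n α′ t′
    _·_  : ∀ {u u′ t t′} → u ≋ᵤ u′ → t ≋ t′ → u · t ≋ u′ · t′

  data _≋ᵤ_ : Unitary → Unitary → Set where
    clauses : ∀ {n b b′ e e′} → (∀ i → b i ≋ b′ i) → (∀ i → e i ≋ e′ i) →
              clauses n b e ≋ᵤ clauses n b′ e′
    _⊗_  : ∀ {u u′ w w′} → u ≋ᵤ u′ → w ≋ᵤ w′ → u ⊗ w ≋ᵤ u′ ⊗ w′
    _⊕_  : ∀ {u u′ w w′} → u ≋ᵤ u′ → w ≋ᵤ w′ → u ⊕ w ≋ᵤ u′ ⊕ w′
    _⊚_  : ∀ {u u′ w w′} → u ≋ᵤ u′ → w ≋ᵤ w′ → u ⊚ w ≋ᵤ u′ ⊚ w′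
    _†   : ∀ {u u′} → u ≋ᵤ u′ → u † ≋ᵤ u′ †
    ctrl : ∀ {u u′} → u ≋ᵤ u′ → ctrl u ≋ᵤ ctrl u′

infix 4 _⊥_

data _⊥_ : Tm term → Tm term → Set where
  ⊥-sym  : ∀ {s t} → s ⊥ t → t ⊥ s
  ⊥-resp : ∀ {s s′ t t′} → s ≋ s′ → t ≋ t′ → s ⊥ t → s′ ⊥ t′
  inl⊥inr : ∀ {s t} → inl s ⊥ inr t
  zero⊥S  : ∀ {t} → zero ⊥ S t
  S    : ∀ {s t} → s ⊥ t → S s ⊥ S t
  inl  : ∀ {s t} → s ⊥ t → inl s ⊥ inl t
  inr  : ∀ {s t} → s ⊥ t → inr s ⊥ inr t
  app  : ∀ {u s t} → s ⊥ t → u · s ⊥ u · t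
  rightᵗ : ∀ {r r′ s t} → s ⊥ t → r ⊗ s ⊥ r′ ⊗ t
  leftᵗ : ∀ {r r′ s t} → s ⊥ t → s ⊗ r ⊥ t ⊗ r′
  sum  : ∀ {t n α s} → (∀ i → t ⊥ s i) → t ⊥ sum n α s
  sum⋆ : ∀ {t n α s} (⋆ᵢ : Fin n) → (∀ i → i ≢ ⋆ᵢ → t ⊥ s i) →
         α ⋆ᵢ ≈ᶜ 0ᶜ → s ⋆ᵢ ≋ t → t ⊥ sum n α s
  -- The subsets J, K ⊆ I = Fin n are enumerated by the injections j, k; the
  -- double sum runs over the pairs of positions naming the same element.
  sums : ∀ {n p q} (t : Fin n → Tm term) (j : Fin p → Fin n) (k : Fin q → Fin n)
         (α : Fin p → ℂ) (β : Fin q → ℂ) →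
         (∀ {a b} → j a ≡ j b → a ≡ b) → (∀ {a b} → k a ≡ k b → a ≡ b) →
         (∀ {i i′} → i ≢ i′ → t i ⊥ t i′) →
         Σᶜ (λ a → Σᶜ (λ b → δ (j a) (k b) *ᶜ (conj (α a) *ᶜ β b))) ≈ᶜ 0ᶜ →
         sum p α (λ a → t (j a)) ⊥ sum q β (λ b → t (k b))

infix 4 _∈_ _≐_

_∈_ : ∀ {k} → Tm k → List (Tm k) → Set
t ∈ X = Any (t ≋_) X

_≐_ : ∀ {k} → List (Tm k) → List (Tm k) → Set
X ≐ Y = ∀ t → t ∈ X ⇔ t ∈ Y

-- Finite sets are lists up to _≐_.  ONB basis is the predicate on basis
-- values, ONB expr the one on expressions.
data ONB : (k : Sort) → QType → List (Tm k) → Set where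
  set-ext : ∀ {k Q X Y} → X ≐ Y → ONB k Q X → ONB k Q Y
  var     : ∀ {k Q} x → ONB k Q (var x ∷ [])
  ⋆       : ∀ {k} → ONB k I (⋆ ∷ [])
  _⊕_     : ∀ {k Q₁ Q₂ X Y} → ONB k Q₁ X → ONB k Q₂ Y →
            ONB k (Q₁ ⊕ Q₂) (List.map inl X List.++ List.map inr Y)
  nat     : ∀ {k X} → ONB k qnat X → ONB k qnat (zero ∷ List.map S X)
  ⊗²      : ∀ {k Q₁ Q₂} (X : List (Tm k × Tm k)) →
            ONB k Q₂ (List.map proj₂ X) →
            (∀ b → b ∈ List.map proj₂ X →
              Σ[ Y ∈ List (Tm k) ]
                (∀ b′ → b′ ∈ Y ⇔ (b′ ⊗ b) ∈ List.map (uncurry _⊗_) X) × ONB k Q₁ Y) →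
            ONB k (Q₁ ⊗ Q₂) (List.map (uncurry _⊗_) X)
  ⊗¹      : ∀ {k Q₁ Q₂} (X : List (Tm k × Tm k)) →
            ONB k Q₁ (List.map proj₁ X) →
            (∀ b → b ∈ List.map proj₁ X →
              Σ[ Y ∈ List (Tm k) ]
                (∀ b′ → b′ ∈ Y ⇔ (b ⊗ b′) ∈ List.map (uncurry _⊗_) X) × ONB k Q₂ Y) →
            ONB k (Q₁ ⊗ Q₂) (List.map (uncurry _⊗_) X)
  unitary : ∀ {Q n} (e : Fin n → Tm expr) (A : Fin n → Fin n → ℂ) →
            (∀ {i j} → i ≢ j → ¬ (e i ≋ e j)) → IsUnitary A →
            ONB expr Q (List.tabulate e) →
            ONB expr Q (List.tabulate (λ i → sum n (A i) e))

PCtx : Set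
PCtx = List (ℕ × QType)

dom : PCtx → List ℕ
dom = List.map proj₁

infix 3 _⊢_∶_ ⊩_∶U⟨_,_⟩

mutual
  data _⊢_∶_ : PCtx → Tm term → QType → Set where
    exch : ∀ {Γ Γ′ t Q} → Γ ↭ Γ′ → Γ ⊢ t ∶ Q → Γ′ ⊢ t ∶ Q
    ⋆    : [] ⊢ ⋆ ∶ I
    var  : ∀ {x Q} → ((x , Q) ∷ []) ⊢ var x ∶ Q
    _⊗_  : ∀ {Γ₁ Γ₂ t₁ t₂ Q₁ Q₂} {Γ₁#Γ₂ : Disjoint (dom Γ₁) (dom Γ₂)} →
           Γ₁ ⊢ t₁ ∶ Q₁ → Γ₂ ⊢ t₂ ∶ Q₂ → (Γ₁ List.++ Γ₂) ⊢ t₁ ⊗ t₂ ∶ Q₁ ⊗ Q₂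
    inl  : ∀ {Γ t Q₁ Q₂} → Γ ⊢ t ∶ Q₁ → Γ ⊢ inl t ∶ Q₁ ⊕ Q₂
    inr  : ∀ {Γ t Q₁ Q₂} → Γ ⊢ t ∶ Q₂ → Γ ⊢ inr t ∶ Q₁ ⊕ Q₂
    zero : [] ⊢ zero ∶ qnat
    S    : ∀ {Γ t} → Γ ⊢ t ∶ qnat → Γ ⊢ S t ∶ qnat
    sum  : ∀ {Γ n α t Q} → (∀ i → Γ ⊢ t i ∶ Q) → Σᴿ (λ i → ∣ α i ∣²) ≈ᴿ 1ᴿ →
           (∀ {i j} → i ≢ j → t i ⊥ t j) → Γ ⊢ sum n α t ∶ Q
    _·_  : ∀ {Γ u t Q₁ Q₂} → ⊩ u ∶U⟨ Q₁ , Q₂ ⟩ → Γ ⊢ t ∶ Q₁ → Γ ⊢ u · t ∶ Q₂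

  data ⊩_∶U⟨_,_⟩ : Unitary → QType → QType → Set where
    clauses : ∀ {n b e Q₁ Q₂} →
              (∀ i → Σ[ Γ ∈ PCtx ] (Γ ⊢ ⌊ b i ⌋ ∶ Q₁) × (Γ ⊢ ⌈ e i ⌉ ∶ Q₂)) →
              (∀ {i j} → i ≢ j → ¬ (b i ≋ b j)) → (∀ {i j} → i ≢ j → ¬ (e i ≋ e j)) →
              ONB basis Q₁ (List.tabulate b) → ONB expr Q₂ (List.tabulate e) →
              ⊩ clauses n b e ∶U⟨ Q₁ , Q₂ ⟩
    _†   : ∀ {u Q₁ Q₂} → ⊩ u ∶U⟨ Q₁ , Q₂ ⟩ → ⊩ u † ∶U⟨ Q₂ , Q₁ ⟩
    _⊚_  : ∀ {u₁ u₂ Q₁ Q₂ Q₃} → ⊩ u₂ ∶U⟨ Q₂ , Q₃ ⟩ → ⊩ u₁ ∶U⟨ Q₁ , Q₂ ⟩ →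
           ⊩ u₂ ⊚ u₁ ∶U⟨ Q₁ , Q₃ ⟩
    _⊗_  : ∀ {u₁ u₂ Q₁ Q₂ Q₃ Q₄} → ⊩ u₁ ∶U⟨ Q₁ , Q₂ ⟩ → ⊩ u₂ ∶U⟨ Q₃ , Q₄ ⟩ →
           ⊩ u₁ ⊗ u₂ ∶U⟨ Q₁ ⊗ Q₃ , Q₂ ⊗ Q₄ ⟩
    _⊕_  : ∀ {u₁ u₂ Q₁ Q₂ Q₃ Q₄} → ⊩ u₁ ∶U⟨ Q₁ , Q₂ ⟩ → ⊩ u₂ ∶U⟨ Q₃ , Q₄ ⟩ →
           ⊩ u₁ ⊕ u₂ ∶U⟨ Q₁ ⊕ Q₃ , Q₂ ⊕ Q₄ ⟩
    ctrl : ∀ {u Q} → ⊩ u ∶U⟨ Q , Q ⟩ → ⊩ ctrl u ∶U⟨ qbit ⊗ Q , qbit ⊗ Q ⟩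

Valuation : Set
Valuation = List (ℕ × Tm expr)

data Match : Valuation → Tm basis → Tm basis → Set where
  ⋆    : Match [] ⋆ ⋆
  var  : ∀ {x b′} → Match ((x , ⌊ b′ ⌋) ∷ []) (var x) b′
  zero : Match [] zero zero
  inl  : ∀ {σ b b′} → Match σ b b′ → Match σ (inl b) (inl b′)
  inr  : ∀ {σ b b′} → Match σ b b′ → Match σ (inr b) (inr b′)
  S    : ∀ {σ b b′} → Match σ b b′ → Match σ (S b) (S b′)
  _⊗_  : ∀ {σ₁ σ₂ b₁ b₂ b₁′ b₂′}
         {σ₁#σ₂ : Disjoint (List.map proj₁ σ₁) (List.map proj₁ σ₂)} →
         Match σ₁ b₁ b₁′ → Match σ₂ b₂ b₂′ →
         Match (σ₁ List.++ σ₂) (b₁ ⊗ b₂) (b₁′ ⊗ b₂′)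

lookupᵥ : Valuation → ℕ → Tm expr
lookupᵥ []            x = var x
lookupᵥ ((y , e) ∷ σ) x = if does (x ℕ.≟ y) then e else lookupᵥ σ x

substᵥ : Valuation → Tm expr → Tm expr
substᵥ σ ⋆           = ⋆
substᵥ σ (var x)     = lookupᵥ σ x
substᵥ σ (inl e)     = inl (substᵥ σ e)
substᵥ σ (inr e)     = inr (substᵥ σ e)
substᵥ σ (e ⊗ f)     = substᵥ σ e ⊗ substᵥ σ f
substᵥ σ zero        = zero
substᵥ σ (S e)       = S (substᵥ σ e)
substᵥ σ (sum {{h}} n α e) = sum {{h}} n α (λ i → substᵥ σ (e i))

data PFrame : Set where
  app         : Unitary → PFrame
  inl inr S   : PFrame
  _⊗- -⊗_     : Tm term → PFrame

_⟨_⟩ : PFrame → Tm term → Tm term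
app u  ⟨ t ⟩ = u · t
inl    ⟨ t ⟩ = inl t
inr    ⟨ t ⟩ = inr t
S      ⟨ t ⟩ = S t
(s ⊗-) ⟨ t ⟩ = s ⊗ t
(-⊗ s) ⟨ t ⟩ = t ⊗ s

-- FrameTy C Γ Q Γ′ Q′: filling C with a term of type Q in Γ gives one of
-- type Q′ in Γ′.
data FrameTy : PFrame → PCtx → QType → PCtx → QType → Set where
  app : ∀ {Γ u Q₁ Q₂} → ⊩ u ∶U⟨ Q₁ , Q₂ ⟩ → FrameTy (app u) Γ Q₁ Γ Q₂
  inl : ∀ {Γ Q₁ Q₂} → FrameTy inl Γ Q₁ Γ (Q₁ ⊕ Q₂)
  inr : ∀ {Γ Q₁ Q₂} → FrameTy inr Γ Q₂ Γ (Q₁ ⊕ Q₂)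
  S   : ∀ {Γ} → FrameTy S Γ qnat Γ qnat
  _⊗- : ∀ {Γ₁ Γ₂ s Q₁ Q₂} {Γ₁#Γ₂ : Disjoint (dom Γ₁) (dom Γ₂)} →
        Γ₁ ⊢ s ∶ Q₁ → FrameTy (s ⊗-) Γ₂ Q₂ (Γ₁ List.++ Γ₂) (Q₁ ⊗ Q₂)
  -⊗_ : ∀ {Γ₁ Γ₂ s Q₁ Q₂} {Γ₁#Γ₂ : Disjoint (dom Γ₁) (dom Γ₂)} →
        Γ₂ ⊢ s ∶ Q₂ → FrameTy (-⊗ s) Γ₁ Q₁ (Γ₁ List.++ Γ₂) (Q₁ ⊗ Q₂)

-- The fixed order on basis values is a parameter.
module Equational (_≺_ : Rel (Tm basis) 0ℓ) where

  record QValue (v : Tm term) : Set where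
    field
      {size}     : ℕ
      scalar     : Fin size → ℂ
      basisVal   : Fin size → Tm basis
      is-sum     : v ≋ sum size scalar (λ i → ⌊ basisVal i ⌋)
      increasing : ∀ {i j} → i Fin.< j → basisVal i ≺ basisVal j
      nonzero    : ∀ i → ¬ (scalar i ≈ᶜ 0ᶜ)

  infix 3 _⊢_≈_∶_

  data _⊢_≈_∶_ : PCtx → Tm term → Tm term → QType → Set where
    ≈-exch  : ∀ {Γ Γ′ s t Q} → Γ ↭ Γ′ → Γ ⊢ s ≈ t ∶ Q → Γ′ ⊢ s ≈ t ∶ Q
    ≈-refl  : ∀ {Γ t t′ Q} → Γ ⊢ t ∶ Q → t ≋ t′ → Γ ⊢ t ≈ t′ ∶ Q
    ≈-sym   : ∀ {Γ s t Q} → Γ ⊢ s ≈ t ∶ Q → Γ ⊢ t ≈ s ∶ Q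
    ≈-trans : ∀ {Γ r s t Q} → Γ ⊢ r ≈ s ∶ Q → Γ ⊢ s ≈ t ∶ Q → Γ ⊢ r ≈ t ∶ Q

    permute : ∀ {Γ n α t Q} (π : Permutation′ n) → Γ ⊢ sum n α t ∶ Q →
              Γ ⊢ sum n α t ≈ sum n (λ i → α (π ⟨$⟩ʳ i)) (λ i → t (π ⟨$⟩ʳ i)) ∶ Q
    delete  : ∀ {Γ n α t Q} (i : Fin (suc n)) → α i ≈ᶜ 0ᶜ → Γ ⊢ sum (suc n) α t ∶ Q →
              Γ ⊢ sum (suc n) α t ≈ sum n (removeAt α i) (removeAt t i) ∶ Q
    single  : ∀ {Γ t Q} → Γ ⊢ t ∶ Q → Γ ⊢ sum 1 (λ _ → 1ᶜ) (λ _ → t) ≈ t ∶ Q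
    collect : ∀ {Γ n m α t Q} {β : Fin n → Fin m → ℂ} →
              Γ ⊢ sum n α (λ i → sum m (β i) t) ∶ Q →
              Γ ⊢ sum n α (λ i → sum m (β i) t)
                ≈ sum m (λ j → Σᶜ (λ i → α i *ᶜ β i j)) t ∶ Q
    -- The pairs (i , j), where the range of j may depend on i, are indexed by
    -- Fin l along a bijection f.
    flatten : ∀ {Γ n l α Q} {m : Fin n → ℕ} {β : ∀ i → Fin (m i) → ℂ}
              {t : ∀ i → Fin (m i) → Tm term} (f : Fin l ↔ Σ (Fin n) (λ i → Fin (m i))) →
              let lhs = sum n α (λ i → sum (m i) (β i) (t i))
                  rhs = sum l (λ k → α (proj₁ (Inverse.to f k)) *ᶜ uncurry β (Inverse.to f k))
                              (λ k → uncurry t (Inverse.to f k))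
              in Γ ⊢ lhs ∶ Q → Γ ⊢ rhs ∶ Q → Γ ⊢ lhs ≈ rhs ∶ Q
    linear  : ∀ {C Γ Q Γ′ Q′ n α t} → FrameTy C Γ Q Γ′ Q′ → Γ ⊢ sum n α t ∶ Q →
              Γ′ ⊢ C ⟨ sum n α t ⟩ ≈ sum n α (λ i → C ⟨ t i ⟩) ∶ Q′

    cong-frame : ∀ {C Γ Q Γ′ Q′ s t} → FrameTy C Γ Q Γ′ Q′ → Γ ⊢ s ≈ t ∶ Q →
                 Γ′ ⊢ C ⟨ s ⟩ ≈ C ⟨ t ⟩ ∶ Q′
    cong-sum   : ∀ {Γ n α t t′ Q} → Γ ⊢ sum n α t ∶ Q → (∀ i → Γ ⊢ t i ≈ t′ i ∶ Q) →
                 Γ ⊢ sum n α t ≈ sum n α t′ ∶ Q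

    -- Typability in the empty context makes the basis values closed.
    β-clauses : ∀ {n b e σ b′ Q} (i : Fin n) → Match σ (b i) b′ →
                [] ⊢ clauses n b e · ⌊ b′ ⌋ ∶ Q →
                [] ⊢ clauses n b e · ⌊ b′ ⌋ ≈ ⌈ substᵥ σ (e i) ⌉ ∶ Q
    β-†       : ∀ {u b v Q₁ Q₂} → ⊩ u ∶U⟨ Q₁ , Q₂ ⟩ → [] ⊢ ⌊ b ⌋ ∶ Q₁ → QValue v →
                [] ⊢ u · ⌊ b ⌋ ≈ v ∶ Q₂ → [] ⊢ u † · v ≈ ⌊ b ⌋ ∶ Q₁
    β-⊚       : ∀ {Γ u₁ u₂ b Q} → Γ ⊢ (u₂ ⊚ u₁) · ⌊ b ⌋ ∶ Q →
                Γ ⊢ (u₂ ⊚ u₁) · ⌊ b ⌋ ≈ u₂ · u₁ · ⌊ b ⌋ ∶ Q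
    β-⊗       : ∀ {u₁ u₂ b₁ b₂ Q} → [] ⊢ (u₁ ⊗ u₂) · (⌊ b₁ ⌋ ⊗ ⌊ b₂ ⌋) ∶ Q →
                [] ⊢ (u₁ ⊗ u₂) · (⌊ b₁ ⌋ ⊗ ⌊ b₂ ⌋) ≈ (u₁ · ⌊ b₁ ⌋) ⊗ (u₂ · ⌊ b₂ ⌋) ∶ Q
    β-⊕ˡ      : ∀ {u₁ u₂ b Q} → [] ⊢ (u₁ ⊕ u₂) · inl ⌊ b ⌋ ∶ Q →
                [] ⊢ (u₁ ⊕ u₂) · inl ⌊ b ⌋ ≈ inl (u₁ · ⌊ b ⌋) ∶ Q
    β-⊕ʳ      : ∀ {u₁ u₂ b Q} → [] ⊢ (u₁ ⊕ u₂) · inr ⌊ b ⌋ ∶ Q →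
                [] ⊢ (u₁ ⊕ u₂) · inr ⌊ b ⌋ ≈ inr (u₂ · ⌊ b ⌋) ∶ Q
    β-ctrlˡ   : ∀ {u b Q} → [] ⊢ ctrl u · (inl ⋆ ⊗ ⌊ b ⌋) ∶ Q →
                [] ⊢ ctrl u · (inl ⋆ ⊗ ⌊ b ⌋) ≈ inl ⋆ ⊗ ⌊ b ⌋ ∶ Q
    β-ctrlʳ   : ∀ {u b Q} → [] ⊢ ctrl u · (inr ⋆ ⊗ ⌊ b ⌋) ∶ Q →
                [] ⊢ ctrl u · (inr ⋆ ⊗ ⌊ b ⌋) ≈ inr ⋆ ⊗ (u · ⌊ b ⌋) ∶ Q

infixr 6 _⊞_
infixr 5 _⊸_

data Type : Set where
  I    : Type
  _⊞_  : Type → Type → Type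
  _⊗_  : Type → Type → Type
  !_   : Type → Type
  _⊸_  : Type → Type → Type
  Nat  : Type
  𝓑    : QType → Type

infixl 8 _∙_

-- Well-scoped de Bruijn terms.  In let⊗ and let𝓑⊗ the first of the two bound
-- variables has index 0 and the second index 1.
data Term (n : ℕ) : Set where
  ⋆      : Term n
  var    : Fin n → Term n
  inl    : Term n → Term n
  inr    : Term n → Term n
  case   : Term n → Term (suc n) → Term (suc n) → Term n
  _⊗_    : Term n → Term n → Term n
  let⊗   : Term n → Term (suc (suc n)) → Term n
  lift   : Term n → Term n
  force  : Term n → Term n
  ƛ      : Term (suc n) → Term n
  _∙_    : Term n → Term n → Term n
  zero   : Term n
  succ   : Term n → Term n
  match  : Term n → Term n → Term (suc n) → Term n
  pure   : Tm term → Term n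
  meas   : Term n → Term n
  apply  : Unitary → Term n → Term n
  let𝓑   : Term n → Term (suc n) → Term n
  let𝓑⊗  : Term n → Term (suc (suc n)) → Term n

data Value {n : ℕ} : Term n → Set where
  ⋆    : Value ⋆
  var  : ∀ x → Value (var x)
  inl  : ∀ {V} → Value V → Value (inl V)
  inr  : ∀ {V} → Value V → Value (inr V)
  _⊗_  : ∀ {V W} → Value V → Value W → Value (V ⊗ W)
  lift : ∀ M → Value (lift M)
  ƛ    : ∀ M → Value (ƛ M)
  zero : Value zero
  succ : ∀ {V} → Value V → Value (succ V)

classicalType : QType → Type
classicalType I         = I
classicalType (Q₁ ⊕ Q₂) = classicalType Q₁ ⊞ classicalType Q₂
classicalType (Q₁ ⊗ Q₂) = classicalType Q₁ ⊗ classicalType Q₂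
classicalType qnat      = Nat

-- Graph of the translation of closed basis values (it is undefined on
-- variables).
data Classical {n : ℕ} : Tm basis → Term n → Set where
  ⋆    : Classical ⋆ ⋆
  _⊗_  : ∀ {b₁ b₂ V₁ V₂} → Classical b₁ V₁ → Classical b₂ V₂ →
         Classical (b₁ ⊗ b₂) (V₁ ⊗ V₂)
  inl  : ∀ {b V} → Classical b V → Classical (inl b) (inl V)
  inr  : ∀ {b V} → Classical b V → Classical (inr b) (inr V)
  zero : Classical zero zero
  S    : ∀ {b V} → Classical b V → Classical (S b) (succ V)

ren : ∀ {m n} → (Fin m → Fin n) → Term m → Term n
ren ρ ⋆             = ⋆
ren ρ (var x)       = var (ρ x)
ren ρ (inl M)       = inl (ren ρ M)
ren ρ (inr M)       = inr (ren ρ M)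
ren ρ (case L M N)  = case (ren ρ L) (ren (Fin.lift 1 ρ) M) (ren (Fin.lift 1 ρ) N)
ren ρ (M ⊗ N)       = ren ρ M ⊗ ren ρ N
ren ρ (let⊗ M N)    = let⊗ (ren ρ M) (ren (Fin.lift 2 ρ) N)
ren ρ (lift M)      = lift (ren ρ M)
ren ρ (force M)     = force (ren ρ M)
ren ρ (ƛ M)         = ƛ (ren (Fin.lift 1 ρ) M)
ren ρ (M ∙ N)       = ren ρ M ∙ ren ρ N
ren ρ zero          = zero
ren ρ (succ M)      = succ (ren ρ M)
ren ρ (match L M N) = match (ren ρ L) (ren ρ M) (ren (Fin.lift 1 ρ) N)
ren ρ (pure t)      = pure t
ren ρ (meas M)      = meas (ren ρ M)
ren ρ (apply u M)   = apply u (ren ρ M)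
ren ρ (let𝓑 M N)    = let𝓑 (ren ρ M) (ren (Fin.lift 1 ρ) N)
ren ρ (let𝓑⊗ M N)   = let𝓑⊗ (ren ρ M) (ren (Fin.lift 2 ρ) N)

exts : ∀ {m n} → (Fin m → Term n) → Fin (suc m) → Term (suc n)
exts σ zero    = var zero
exts σ (suc x) = ren suc (σ x)

sub : ∀ {m n} → (Fin m → Term n) → Term m → Term n
sub σ ⋆             = ⋆
sub σ (var x)       = σ x
sub σ (inl M)       = inl (sub σ M)
sub σ (inr M)       = inr (sub σ M)
sub σ (case L M N)  = case (sub σ L) (sub (exts σ) M) (sub (exts σ) N)
sub σ (M ⊗ N)       = sub σ M ⊗ sub σ N
sub σ (let⊗ M N)    = let⊗ (sub σ M) (sub (exts (exts σ)) N)
sub σ (lift M)      = lift (sub σ M)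
sub σ (force M)     = force (sub σ M)
sub σ (ƛ M)         = ƛ (sub (exts σ) M)
sub σ (M ∙ N)       = sub σ M ∙ sub σ N
sub σ zero          = zero
sub σ (succ M)      = succ (sub σ M)
sub σ (match L M N) = match (sub σ L) (sub σ M) (sub (exts σ) N)
sub σ (pure t)      = pure t
sub σ (meas M)      = meas (sub σ M)
sub σ (apply u M)   = apply u (sub σ M)
sub σ (let𝓑 M N)    = let𝓑 (sub σ M) (sub (exts σ) N)
sub σ (let𝓑⊗ M N)   = let𝓑⊗ (sub σ M) (sub (exts (exts σ)) N)

infix 8 _[_] _[_∥_]

_[_] : ∀ {n} → Term (suc n) → Term n → Term n
_[_] {n} M V = sub σ M
  where
  σ : Fin (suc n) → Term n
  σ zero    = V
  σ (suc x) = var x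

_[_∥_] : ∀ {n} → Term (suc (suc n)) → Term n → Term n → Term n
_[_∥_] {n} M V W = sub σ M
  where
  σ : Fin (suc (suc n)) → Term n
  σ zero          = V
  σ (suc zero)    = W
  σ (suc (suc x)) = var x

-- A context assigns a type to some of the variables in scope.
Ctx : ℕ → Set
Ctx n = Vec (Maybe Type) n

data Unused : Maybe Type → Set where
  absent : Unused nothing
  bang   : ∀ {A} → Unused (just (! A))

-- Γ has the form !Δ.
Bang : ∀ {n} → Ctx n → Set
Bang = All Unused

data Split₁ : Maybe Type → Maybe Type → Maybe Type → Set where
  absent : Split₁ nothing nothing nothing
  shared : ∀ {A} → Split₁ (just (! A)) (just (! A)) (just (! A))
  left   : ∀ {A} → Split₁ (just A) (just A) nothing
  right  : ∀ {A} → Split₁ (just A) nothing (just A)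

-- Split Γ Γ₁ Γ₂: Γ = !Δ,Σ₁,Σ₂ with Γ₁ = !Δ,Σ₁ and Γ₂ = !Δ,Σ₂.
data Split : ∀ {n} → Ctx n → Ctx n → Ctx n → Set where
  []  : Split [] [] []
  _∷_ : ∀ {n a a₁ a₂} {Γ Γ₁ Γ₂ : Ctx n} →
        Split₁ a a₁ a₂ → Split Γ Γ₁ Γ₂ → Split (a ∷ Γ) (a₁ ∷ Γ₁) (a₂ ∷ Γ₂)

infix 3 _⊢ᵐ_∶_

data _⊢ᵐ_∶_ {n : ℕ} : Ctx n → Term n → Type → Set where
  ⋆     : ∀ {Γ} → Bang Γ → Γ ⊢ᵐ ⋆ ∶ I
  var   : ∀ {Γ A} x → Vec.lookup Γ x ≡ just A →
          (∀ y → y ≢ x → Unused (Vec.lookup Γ y)) → Γ ⊢ᵐ var x ∶ A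
  inl   : ∀ {Γ M A B} → Γ ⊢ᵐ M ∶ A → Γ ⊢ᵐ inl M ∶ A ⊞ B
  inr   : ∀ {Γ M A B} → Γ ⊢ᵐ M ∶ B → Γ ⊢ᵐ inr M ∶ A ⊞ B
  case  : ∀ {Γ Γ₁ Γ₂ L M N A B C} → Split Γ Γ₁ Γ₂ → Γ₁ ⊢ᵐ L ∶ A ⊞ B →
          (just A ∷ Γ₂) ⊢ᵐ M ∶ C → (just B ∷ Γ₂) ⊢ᵐ N ∶ C → Γ ⊢ᵐ case L M N ∶ C
  tens  : ∀ {Γ Γ₁ Γ₂ M N A B} → Split Γ Γ₁ Γ₂ → Γ₁ ⊢ᵐ M ∶ A → Γ₂ ⊢ᵐ N ∶ B →
          Γ ⊢ᵐ M ⊗ N ∶ A ⊗ B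
  let⊗  : ∀ {Γ Γ₁ Γ₂ M N A B C} → Split Γ Γ₁ Γ₂ → Γ₁ ⊢ᵐ M ∶ A ⊗ B →
          (just A ∷ just B ∷ Γ₂) ⊢ᵐ N ∶ C → Γ ⊢ᵐ let⊗ M N ∶ C
  lift  : ∀ {Γ M A} → Bang Γ → Γ ⊢ᵐ M ∶ A → Γ ⊢ᵐ lift M ∶ ! A
  force : ∀ {Γ M A} → Γ ⊢ᵐ M ∶ ! A → Γ ⊢ᵐ force M ∶ A
  ƛ     : ∀ {Γ M A B} → (just A ∷ Γ) ⊢ᵐ M ∶ B → Γ ⊢ᵐ ƛ M ∶ A ⊸ B
  app   : ∀ {Γ Γ₁ Γ₂ M N A B} → Split Γ Γ₁ Γ₂ → Γ₁ ⊢ᵐ M ∶ A ⊸ B → Γ₂ ⊢ᵐ N ∶ A →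
          Γ ⊢ᵐ M ∙ N ∶ B
  zero  : ∀ {Γ} → Bang Γ → Γ ⊢ᵐ zero ∶ Nat
  succ  : ∀ {Γ M} → Γ ⊢ᵐ M ∶ Nat → Γ ⊢ᵐ succ M ∶ Nat
  match : ∀ {Γ Γ₁ Γ₂ L M N A} → Split Γ Γ₁ Γ₂ → Γ₁ ⊢ᵐ L ∶ Nat → Γ₂ ⊢ᵐ M ∶ A →
          (just Nat ∷ Γ₂) ⊢ᵐ N ∶ A → Γ ⊢ᵐ match L M N ∶ A
  pure  : ∀ {Γ t Q} → Bang Γ → [] ⊢ t ∶ Q → Γ ⊢ᵐ pure t ∶ 𝓑 Q
  meas  : ∀ {Γ M Q} → Γ ⊢ᵐ M ∶ 𝓑 Q → Γ ⊢ᵐ meas M ∶ classicalType Q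
  apply : ∀ {Γ u M Q₁ Q₂} → ⊩ u ∶U⟨ Q₁ , Q₂ ⟩ → Γ ⊢ᵐ M ∶ 𝓑 Q₁ → Γ ⊢ᵐ apply u M ∶ 𝓑 Q₂
  let𝓑  : ∀ {Γ Γ₁ Γ₂ M N Q₁ Q₂ A} → Split Γ Γ₁ Γ₂ → Γ₁ ⊢ᵐ M ∶ 𝓑 Q₁ ⊗ 𝓑 Q₂ →
          (just (𝓑 (Q₁ ⊗ Q₂)) ∷ Γ₂) ⊢ᵐ N ∶ A → Γ ⊢ᵐ let𝓑 M N ∶ A
  let𝓑⊗ : ∀ {Γ Γ₁ Γ₂ M N Q₁ Q₂ A} → Split Γ Γ₁ Γ₂ → Γ₁ ⊢ᵐ M ∶ 𝓑 (Q₁ ⊗ Q₂) →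
          (just (𝓑 Q₁) ∷ just (𝓑 Q₂) ∷ Γ₂) ⊢ᵐ N ∶ A → Γ ⊢ᵐ let𝓑⊗ M N ∶ A

data ECtx (n : ℕ) : Set where
  hole  : ECtx n
  _⊗ˡ_  : ECtx n → Term n → ECtx n
  _⊗ʳ_  : ∀ {V : Term n} → Value V → ECtx n → ECtx n
  let⊗  : ECtx n → Term (suc (suc n)) → ECtx n
  inl   : ECtx n → ECtx n
  inr   : ECtx n → ECtx n
  case  : ECtx n → Term (suc n) → Term (suc n) → ECtx n
  force : ECtx n → ECtx n
  succ  : ECtx n → ECtx n
  match : ECtx n → Term n → Term (suc n) → ECtx n
  _∙ˡ_  : ECtx n → Term n → ECtx n
  _∙ʳ_  : ∀ {V : Term n} → Value V → ECtx n → ECtx n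
  meas  : ECtx n → ECtx n
  apply : Unitary → ECtx n → ECtx n
  let𝓑  : ECtx n → Term (suc n) → ECtx n
  let𝓑⊗ : ECtx n → Term (suc (suc n)) → ECtx n

plug : ∀ {n} → ECtx n → Term n → Term n
plug hole              M = M
plug (E ⊗ˡ N)          M = plug E M ⊗ N
plug (_⊗ʳ_ {V = V} _ E) M = V ⊗ plug E M
plug (let⊗ E N)        M = let⊗ (plug E M) N
plug (inl E)           M = inl (plug E M)
plug (inr E)           M = inr (plug E M)
plug (case E N₁ N₂)    M = case (plug E M) N₁ N₂
plug (force E)         M = force (plug E M)
plug (succ E)          M = succ (plug E M)
plug (match E N₁ N₂)   M = match (plug E M) N₁ N₂
plug (E ∙ˡ N)          M = plug E M ∙ N
plug (_∙ʳ_ {V = V} _ E) M = V ∙ plug E M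
plug (meas E)          M = meas (plug E M)
plug (apply u E)       M = apply u (plug E M)
plug (let𝓑 E N)        M = let𝓑 (plug E M) N
plug (let𝓑⊗ E N)       M = let𝓑⊗ (plug E M) N

ren-value : ∀ {m n} (ρ : Fin m → Fin n) {V} → Value V → Value (ren ρ V)
ren-value ρ ⋆        = ⋆
ren-value ρ (var x)  = var (ρ x)
ren-value ρ (inl v)  = inl (ren-value ρ v)
ren-value ρ (inr v)  = inr (ren-value ρ v)
ren-value ρ (v ⊗ w)  = ren-value ρ v ⊗ ren-value ρ w
ren-value ρ (lift M) = lift (ren ρ M)
ren-value ρ (ƛ M)    = ƛ (ren (Fin.lift 1 ρ) M)
ren-value ρ zero     = zero
ren-value ρ (succ v) = succ (ren-value ρ v)

renᴱ : ∀ {m n} → (Fin m → Fin n) → ECtx m → ECtx n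
renᴱ ρ hole            = hole
renᴱ ρ (E ⊗ˡ N)        = renᴱ ρ E ⊗ˡ ren ρ N
renᴱ ρ (v ⊗ʳ E)        = ren-value ρ v ⊗ʳ renᴱ ρ E
renᴱ ρ (let⊗ E N)      = let⊗ (renᴱ ρ E) (ren (Fin.lift 2 ρ) N)
renᴱ ρ (inl E)         = inl (renᴱ ρ E)
renᴱ ρ (inr E)         = inr (renᴱ ρ E)
renᴱ ρ (case E N₁ N₂)  = case (renᴱ ρ E) (ren (Fin.lift 1 ρ) N₁) (ren (Fin.lift 1 ρ) N₂)
renᴱ ρ (force E)       = force (renᴱ ρ E)
renᴱ ρ (succ E)        = succ (renᴱ ρ E)
renᴱ ρ (match E N₁ N₂) = match (renᴱ ρ E) (ren ρ N₁) (ren (Fin.lift 1 ρ) N₂)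
renᴱ ρ (E ∙ˡ N)        = renᴱ ρ E ∙ˡ ren ρ N
renᴱ ρ (v ∙ʳ E)        = ren-value ρ v ∙ʳ renᴱ ρ E
renᴱ ρ (meas E)        = meas (renᴱ ρ E)
renᴱ ρ (apply u E)     = apply u (renᴱ ρ E)
renᴱ ρ (let𝓑 E N)      = let𝓑 (renᴱ ρ E) (ren (Fin.lift 1 ρ) N)
renᴱ ρ (let𝓑⊗ E N)     = let𝓑⊗ (renᴱ ρ E) (ren (Fin.lift 2 ρ) N)

-- E[M], where M and E have disjoint free variables: those of M come first.
fill : ∀ {k l} → ECtx l → Term k → Term (k ℕ.+ l)
fill {k} {l} E M = plug (renᴱ (k ↑ʳ_) E) (ren (_↑ˡ l) M)

data Perm : QType → QType → Set where
  id    : ∀ {A} → Perm A A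
  _⊚_   : ∀ {A B C} → Perm B C → Perm A B → Perm A C
  _⊗_   : ∀ {A B C D} → Perm A B → Perm C D → Perm (A ⊗ C) (B ⊗ D)
  λ⇒    : ∀ {A} → Perm (I ⊗ A) A
  λ⇐    : ∀ {A} → Perm A (I ⊗ A)
  ρ⇒    : ∀ {A} → Perm (A ⊗ I) A
  ρ⇐    : ∀ {A} → Perm A (A ⊗ I)
  α⇒    : ∀ {A B C} → Perm ((A ⊗ B) ⊗ C) (A ⊗ (B ⊗ C))
  α⇐    : ∀ {A B C} → Perm (A ⊗ (B ⊗ C)) ((A ⊗ B) ⊗ C)
  swap  : ∀ {A B} → Perm (A ⊗ B) (B ⊗ A)

_↦_ : Tm basis → Tm basis → Unitary
b ↦ b′ = clauses 1 (λ _ → b) (λ _ → ⌊ b′ ⌋)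

private
  x y z : Tm basis
  x = var 0
  y = var 1
  z = var 2

toUnitary : ∀ {A B} → Perm A B → Unitary
toUnitary id      = x ↦ x
toUnitary (τ ⊚ σ) = toUnitary τ ⊚ toUnitary σ
toUnitary (σ ⊗ τ) = toUnitary σ ⊗ toUnitary τ
toUnitary λ⇒      = (⋆ ⊗ x) ↦ x
toUnitary λ⇐      = x ↦ (⋆ ⊗ x)
toUnitary ρ⇒      = (x ⊗ ⋆) ↦ x
toUnitary ρ⇐      = x ↦ (x ⊗ ⋆)
toUnitary α⇒      = ((x ⊗ y) ⊗ z) ↦ (x ⊗ (y ⊗ z))
toUnitary α⇐      = (x ⊗ (y ⊗ z)) ↦ ((x ⊗ y) ⊗ z)
toUnitary swap    = (x ⊗ y) ↦ (y ⊗ x)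

-- The closed basis values of a type, which index the orthonormal basis of the
-- Hilbert space it denotes.
⟦_⟧ : QType → Set
⟦ I ⟧     = ⊤
⟦ A ⊕ B ⟧ = ⟦ A ⟧ ⊎ ⟦ B ⟧
⟦ A ⊗ B ⟧ = ⟦ A ⟧ × ⟦ B ⟧
⟦ qnat ⟧  = ℕ

act : ∀ {A B} → Perm A B → ⟦ A ⟧ → ⟦ B ⟧
act id      a             = a
act (τ ⊚ σ) a             = act τ (act σ a)
act (σ ⊗ τ) (a , b)       = act σ a , act τ b
act λ⇒      (_ , a)       = a
act λ⇐      a             = tt , a
act ρ⇒      (a , _)       = a
act ρ⇐      a             = a , tt
act α⇒      ((a , b) , c) = a , (b , c)
act α⇐      (a , (b , c)) = (a , b) , c
act swap    (a , b)       = b , a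

-- A permutation maps basis vectors to basis vectors, so its action on these
-- determines the isomorphism it denotes.
infix 4 _≈ₚ_
_≈ₚ_ : ∀ {A B} → Perm A B → Perm A B → Set
σ ≈ₚ τ = ∀ a → act σ a ≡ act τ a

⨂ : List QType → QType
⨂ []             = I
⨂ (Q ∷ [])       = Q
⨂ (Q ∷ Qs@(_ ∷ _)) = Q ⊗ ⨂ Qs

-- ⨂ (Q ∷ Qs) is Q ⊗ ⨂ Qs up to a right unitor when Qs is empty.
cons : ∀ Q Qs → Perm (Q ⊗ ⨂ Qs) (⨂ (Q ∷ Qs))
cons Q []      = ρ⇒
cons Q (_ ∷ _) = id

uncons : ∀ Q Qs → Perm (⨂ (Q ∷ Qs)) (Q ⊗ ⨂ Qs)
uncons Q []      = ρ⇐
uncons Q (_ ∷ _) = id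

gather : ∀ Q₁ Q₂ Qs → Perm (⨂ (Q₁ ∷ Q₂ ∷ Qs)) (⨂ ((Q₁ ⊗ Q₂) ∷ Qs))
gather Q₁ Q₂ []      = id
gather Q₁ Q₂ (_ ∷ _) = α⇐

divide : ∀ Q₁ Q₂ Qs → Perm (⨂ ((Q₁ ⊗ Q₂) ∷ Qs)) (⨂ (Q₁ ∷ Q₂ ∷ Qs))
divide Q₁ Q₂ []      = id
divide Q₁ Q₂ (_ ∷ _) = α⇒

infixr 5 _▹_
_▹_ : ∀ {m} → Vec QType m → List QType → List QType
Qs ▹ Ks = Vec.foldr′ _∷_ Ks Qs

++-▹ : ∀ {k l} (Qs : Vec QType k) (Ls : Vec QType l) Ks → Qs ▹ (Ls ▹ Ks) ≡ (Qs Vec.++ Ls) ▹ Ks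
++-▹ []       Ls Ks = refl
++-▹ (Q ∷ Qs) Ls Ks = cong (Q ∷_) (++-▹ Qs Ls Ks)

id≡ : ∀ {A B} → A ≡ B → Perm A B
id≡ refl = id

-- Extension of a permutation by the identity on the blocks Qs.
under : ∀ {m Ks Ls} (Qs : Vec QType m) → Perm (⨂ Ks) (⨂ Ls) → Perm (⨂ (Qs ▹ Ks)) (⨂ (Qs ▹ Ls))
under                []       σ = σ
under {Ks = Ks} {Ls} (Q ∷ Qs) σ = cons Q (Qs ▹ Ls) ⊚ (id ⊗ under Qs σ) ⊚ uncons Q (Qs ▹ Ks)

-- The free variables of body are the block indices: variable i of body
-- represents the i-th of the blocks, and the auxiliary blocks come after.
record Config : Set where
  constructor [_∣_]⟨_,_,_⟩
  field
    {size}   : ℕ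
    {source} : QType
    blocks   : Vec QType size
    aux      : List QType
    state    : Tm term
    perm     : Perm source (⨂ (blocks ▹ aux))
    body     : Term size

open Config public

unbind : ∀ {n} → List (Fin (suc n)) → List (Fin n)
unbind []           = []
unbind (zero  ∷ xs) = unbind xs
unbind (suc i ∷ xs) = i ∷ unbind xs

occurrences : ∀ {n} → Term n → List (Fin n)
occurrences ⋆             = []
occurrences (var i)       = i ∷ []
occurrences (inl M)       = occurrences M
occurrences (inr M)       = occurrences M
occurrences (case L M N)  = occurrences L List.++ unbind (occurrences M) List.++ unbind (occurrences N)
occurrences (M ⊗ N)       = occurrences M List.++ occurrences N
occurrences (let⊗ M N)    = occurrences M List.++ unbind (unbind (occurrences N))
occurrences (lift M)      = occurrences M
occurrences (force M)     = occurrences M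
occurrences (ƛ M)         = unbind (occurrences M)
occurrences (M ∙ N)       = occurrences M List.++ occurrences N
occurrences zero          = []
occurrences (succ M)      = occurrences M
occurrences (match L M N) = occurrences L List.++ occurrences M List.++ unbind (occurrences N)
occurrences (pure t)      = []
occurrences (meas M)      = occurrences M
occurrences (apply u M)   = occurrences M
occurrences (let𝓑 M N)    = occurrences M List.++ unbind (occurrences N)
occurrences (let𝓑⊗ M N)   = occurrences M List.++ unbind (unbind (occurrences N))

-- In in-order, a variable shared by several branches counts at its first
-- occurrence.
-- The source is not decomposed: every type is a (possibly unary) tensor.
record WellFormed (C : Config) (A : Type) : Set where
  field
    state-typed : [] ⊢ state C ∶ source C
    perm-typed  : ⊩ toUnitary (perm C) ∶U⟨ source C , ⨂ (blocks C ▹ aux C) ⟩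
    body-typed  : Vec.map (λ Q → just (𝓑 Q)) (blocks C) ⊢ᵐ body C ∶ A
    in-order    : List.deduplicate Fin._≟_ (occurrences (body C)) ≡ List.allFin (size C)

infix 4 _⇄_
data _⇄_ : ∀ {m} → Vec QType m → Vec QType m → Set where
  refl  : ∀ {m} {Qs : Vec QType m} → Qs ⇄ Qs
  prep  : ∀ {m} Q {Qs Rs : Vec QType m} → Qs ⇄ Rs → Q ∷ Qs ⇄ Q ∷ Rs
  swap  : ∀ {m} P Q (Qs : Vec QType m) → P ∷ Q ∷ Qs ⇄ Q ∷ P ∷ Qs
  _⨾_   : ∀ {m} {Ps Qs Rs : Vec QType m} → Ps ⇄ Qs → Qs ⇄ Rs → Ps ⇄ Rs

reindex : ∀ {m} {Qs Rs : Vec QType m} → Qs ⇄ Rs → Fin m → Fin m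
reindex refl         i             = i
reindex (prep Q π)   i             = Fin.lift 1 (reindex π) i
reindex (swap P Q _) zero          = suc zero
reindex (swap P Q _) (suc zero)    = zero
reindex (swap P Q _) (suc (suc i)) = suc (suc i)
reindex (π ⨾ ψ)      i             = reindex ψ (reindex π i)

rearrange : ∀ {m} {Qs Rs : Vec QType m} → Qs ⇄ Rs → ∀ Ks → Perm (⨂ (Qs ▹ Ks)) (⨂ (Rs ▹ Ks))
rearrange refl Ks = id
rearrange (prep Q {Qs} {Rs} π) Ks =
  cons Q (Rs ▹ Ks) ⊚ (id ⊗ rearrange π Ks) ⊚ uncons Q (Qs ▹ Ks)
rearrange (swap P Q Qs) Ks =
  (id ⊗ cons P (Qs ▹ Ks)) ⊚ α⇒ ⊚ (swap ⊗ id) ⊚ α⇐ ⊚ (id ⊗ uncons Q (Qs ▹ Ks))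
rearrange (π ⨾ ψ) Ks = rearrange ψ Ks ⊚ rearrange π Ks

-- Configurations are considered up to the denotation of the permutation and
-- up to renaming the variables, i.e. listing the blocks in another order.
infix 4 _∼_ _≅_
data _∼_ : Config → Config → Set where
  perm-≈ : ∀ {m Q} {Qs : Vec QType m} {Ks t M} {σ τ : Perm Q (⨂ (Qs ▹ Ks))} → σ ≈ₚ τ →
           [ Qs ∣ Ks ]⟨ t , σ , M ⟩ ∼ [ Qs ∣ Ks ]⟨ t , τ , M ⟩
  rename : ∀ {m Q} {Qs Rs : Vec QType m} {Ks t M} {σ : Perm Q (⨂ (Qs ▹ Ks))} (π : Qs ⇄ Rs) →
           [ Qs ∣ Ks ]⟨ t , σ , M ⟩ ∼
           [ Rs ∣ Ks ]⟨ t , rearrange π Ks ⊚ σ , ren (reindex π) M ⟩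

_≅_ : Config → Config → Set
_≅_ = EqClosure _∼_

-- Inner Q P R: a proper tensor position in Q holding a component of type P,
-- with R what remains of Q when that component is deleted.  Positions are
-- paths, so that a tensor product may be bracketed in any way.
data Inner : QType → QType → QType → Set where
  fst   : ∀ {A B} → Inner (A ⊗ B) A B
  snd   : ∀ {A B} → Inner (A ⊗ B) B A
  left  : ∀ {A B P R} → Inner A P R → Inner (A ⊗ B) P (R ⊗ B)
  right : ∀ {A B P R} → Inner B P R → Inner (A ⊗ B) P (A ⊗ R)

data Pos : QType → QType → QType → Set where
  whole : ∀ {Q} → Pos Q Q I
  inner : ∀ {Q P R} → Inner Q P R → Pos Q P R

-- The components b′ ⊗ ⋯ ⊗ - ⊗ ⋯ ⊗ b″ around a position.
Aroundᴵ : ∀ {Q P R} → Inner Q P R → Set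
Aroundᴵ fst       = Tm basis
Aroundᴵ snd       = Tm basis
Aroundᴵ (left s)  = Aroundᴵ s × Tm basis
Aroundᴵ (right s) = Tm basis × Aroundᴵ s

insertᴵ : ∀ {Q P R} (s : Inner Q P R) → Aroundᴵ s → Tm basis → Tm basis
insertᴵ fst       b″       b = b ⊗ b″
insertᴵ snd       b′       b = b′ ⊗ b
insertᴵ (left s)  (K , b″) b = insertᴵ s K b ⊗ b″
insertᴵ (right s) (b′ , K) b = b′ ⊗ insertᴵ s K b

restᴵ : ∀ {Q P R} (s : Inner Q P R) → Aroundᴵ s → Tm basis
restᴵ fst       b″       = b″
restᴵ snd       b′       = b′
restᴵ (left s)  (K , b″) = restᴵ s K ⊗ b″
restᴵ (right s) (b′ , K) = b′ ⊗ restᴵ s K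

frontᴵ : ∀ {Q P R} → Inner Q P R → Perm Q (P ⊗ R)
frontᴵ fst       = id
frontᴵ snd       = swap
frontᴵ (left s)  = α⇒ ⊚ (frontᴵ s ⊗ id)
frontᴵ (right s) = α⇒ ⊚ (swap ⊗ id) ⊚ α⇐ ⊚ (id ⊗ frontᴵ s)

Around : ∀ {Q P R} → Pos Q P R → Set
Around whole     = ⊤
Around (inner s) = Aroundᴵ s

insert : ∀ {Q P R} (s : Pos Q P R) → Around s → Tm basis → Tm basis
insert whole     _ b = b
insert (inner s) K b = insertᴵ s K b

rest : ∀ {Q P R} (s : Pos Q P R) → Around s → Tm basis
rest whole     _ = ⋆
rest (inner s) K = restᴵ s K

front : ∀ {Q P R} → Pos Q P R → Perm Q (P ⊗ R)
front whole     = ρ⇐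
front (inner s) = frontᴵ s

-- u ⊗ id on the first block of ⨂ (Q ∷ Ks), where no id is needed if Ks is empty.
onFirst : List QType → Unitary → Unitary
onFirst []      u = u
onFirst (_ ∷ _) u = u ⊗ toUnitary (id {I})

infix 3 _→[_]_

data _→[_]_ : Config → ℝ → Config → Set where
  case-inl : ∀ {m Q} {Qs : Vec QType m} {Ks t V M N} {σ : Perm Q (⨂ (Qs ▹ Ks))} → Value V →
    [ Qs ∣ Ks ]⟨ t , σ , case (inl V) M N ⟩ →[ 1ᴿ ] [ Qs ∣ Ks ]⟨ t , σ , M [ V ] ⟩
  case-inr : ∀ {m Q} {Qs : Vec QType m} {Ks t V M N} {σ : Perm Q (⨂ (Qs ▹ Ks))} → Value V →
    [ Qs ∣ Ks ]⟨ t , σ , case (inr V) M N ⟩ →[ 1ᴿ ] [ Qs ∣ Ks ]⟨ t , σ , N [ V ] ⟩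
  let⊗ : ∀ {m Q} {Qs : Vec QType m} {Ks t V W M} {σ : Perm Q (⨂ (Qs ▹ Ks))} → Value V → Value W →
    [ Qs ∣ Ks ]⟨ t , σ , let⊗ (V ⊗ W) M ⟩ →[ 1ᴿ ] [ Qs ∣ Ks ]⟨ t , σ , M [ V ∥ W ] ⟩
  force : ∀ {m Q} {Qs : Vec QType m} {Ks t M} {σ : Perm Q (⨂ (Qs ▹ Ks))} →
    [ Qs ∣ Ks ]⟨ t , σ , force (lift M) ⟩ →[ 1ᴿ ] [ Qs ∣ Ks ]⟨ t , σ , M ⟩
  beta : ∀ {m Q} {Qs : Vec QType m} {Ks t M V} {σ : Perm Q (⨂ (Qs ▹ Ks))} → Value V →
    [ Qs ∣ Ks ]⟨ t , σ , ƛ M ∙ V ⟩ →[ 1ᴿ ] [ Qs ∣ Ks ]⟨ t , σ , M [ V ] ⟩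
  match-zero : ∀ {m Q} {Qs : Vec QType m} {Ks t M N} {σ : Perm Q (⨂ (Qs ▹ Ks))} →
    [ Qs ∣ Ks ]⟨ t , σ , match zero M N ⟩ →[ 1ᴿ ] [ Qs ∣ Ks ]⟨ t , σ , M ⟩
  match-succ : ∀ {m Q} {Qs : Vec QType m} {Ks t V M N} {σ : Perm Q (⨂ (Qs ▹ Ks))} → Value V →
    [ Qs ∣ Ks ]⟨ t , σ , match (succ V) M N ⟩ →[ 1ᴿ ] [ Qs ∣ Ks ]⟨ t , σ , N [ V ] ⟩

  pure : ∀ {Q Q′ Ks t t′} {σ : Perm Q (⨂ Ks)} → [] ⊢ t′ ∶ Q′ →
    [ [] ∣ Ks ]⟨ t , σ , pure t′ ⟩
      →[ 1ᴿ ]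
    [ Q′ ∷ [] ∣ Ks ]⟨ t ⊗ t′ , cons Q′ Ks ⊚ swap ⊚ (σ ⊗ id) , var zero ⟩

  -- w arranges the components other than the measured one into the auxiliary
  -- blocks; with strictly associative tensors and no rearrangement it is the
  -- identity.
  meas : ∀ {Q P R Ks n} (s : Pos Q P R) (w : Perm R (⨂ Ks))
    (p : Fin n → ℝ) (m : Fin n → ℕ) (α : ∀ i → Fin (m i) → ℂ)
    (b : Fin n → Tm basis) (b′ : ∀ i → Fin (m i) → Around s) →
    (∀ i → Positiveᴿ (p i)) → (∀ {i j} → i ≢ j → b i ≢ b j) →
    (k : Fin n) {V : Term 0} → Classical (b k) V →
    [ P ∷ [] ∣ Ks ]⟨ sum n (λ i → ofReal (p i)) (λ i → sum (m i) (α i) (λ j → ⌊ insert s (b′ i j) (b i) ⌋))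
                   , cons P Ks ⊚ (id ⊗ w) ⊚ front s
                   , meas (var zero) ⟩
      →[ ∣ ofReal (p k) ∣² ]
    [ [] ∣ Ks ]⟨ sum (m k) (α k) (λ j → ⌊ rest s (b′ k j) ⌋) , w , V ⟩

  -- σ′ is the permutation σ read at the types of the new state: both are the
  -- same unitary.
  apply : ∀ {Q Q′ Q₁ Q₂ Ks t u} {σ : Perm Q (⨂ (Q₁ ∷ Ks))} {σ′ : Perm Q′ (⨂ (Q₂ ∷ Ks))} →
    ⊩ u ∶U⟨ Q₁ , Q₂ ⟩ → toUnitary σ ≡ toUnitary σ′ →
    [ Q₁ ∷ [] ∣ Ks ]⟨ t , σ , apply u (var zero) ⟩
      →[ 1ᴿ ]
    [ Q₂ ∷ [] ∣ Ks ]⟨ (toUnitary σ † ⊚ onFirst Ks u ⊚ toUnitary σ) · t , σ′ , var zero ⟩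

  let𝓑 : ∀ {m Q Q₁ Q₂} {Qs : Vec QType m} {Ks t} {N : Term (suc m)}
    {σ : Perm Q (⨂ (Q₁ ∷ Q₂ ∷ Qs ▹ Ks))} →
    [ Q₁ ∷ Q₂ ∷ Qs ∣ Ks ]⟨ t , σ , let𝓑 (var zero ⊗ var (suc zero)) (ren (Fin.lift 1 (2 ↑ʳ_)) N) ⟩
      →[ 1ᴿ ]
    [ (Q₁ ⊗ Q₂) ∷ Qs ∣ Ks ]⟨ t , gather Q₁ Q₂ (Qs ▹ Ks) ⊚ σ , N ⟩

  let𝓑⊗ : ∀ {m Q Q₁ Q₂} {Qs : Vec QType m} {Ks t} {N : Term (suc (suc m))}
    {σ : Perm Q (⨂ ((Q₁ ⊗ Q₂) ∷ Qs ▹ Ks))} →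
    [ (Q₁ ⊗ Q₂) ∷ Qs ∣ Ks ]⟨ t , σ , let𝓑⊗ (var zero) (ren (Fin.lift 2 suc) N) ⟩
      →[ 1ᴿ ]
    [ Q₁ ∷ Q₂ ∷ Qs ∣ Ks ]⟨ t , divide Q₁ Q₂ (Qs ▹ Ks) ⊚ σ , N ⟩

  -- under Qsᵢ τ is the part of the permutation common to both sides: it is the
  -- identity on the blocks represented in Mᵢ, and τ brings the blocks Ls linked
  -- to the variables of E, auxiliary in the premise, right after these.  Other
  -- listings of the variables of E[Mᵢ] are reached with up-to.
  context : ∀ {k₁ k₂ l p S₁ S₂} {Qs₁ : Vec QType k₁} {Qs₂ : Vec QType k₂} {Ls : Vec QType l}
    {Ks Ks′ t₁ t₂ M₁ M₂} {σ₁ : Perm S₁ (⨂ (Qs₁ ▹ Ks))} {σ₂ : Perm S₂ (⨂ (Qs₂ ▹ Ks))}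
    (E : ECtx l) (τ : Perm (⨂ Ks) (⨂ (Ls ▹ Ks′))) →
    [ Qs₁ ∣ Ks ]⟨ t₁ , σ₁ , M₁ ⟩ →[ p ] [ Qs₂ ∣ Ks ]⟨ t₂ , σ₂ , M₂ ⟩ →
    [ Qs₁ Vec.++ Ls ∣ Ks′ ]⟨ t₁ , id≡ (cong ⨂ (++-▹ Qs₁ Ls Ks′)) ⊚ under Qs₁ τ ⊚ σ₁ , fill E M₁ ⟩
      →[ p ]
    [ Qs₂ Vec.++ Ls ∣ Ks′ ]⟨ t₂ , id≡ (cong ⨂ (++-▹ Qs₂ Ls Ks′)) ⊚ under Qs₂ τ ⊚ σ₂ , fill E M₂ ⟩

  up-to : ∀ {C C′ D D′ p} → C ≅ C′ → C′ →[ p ] D′ → D′ ≅ D → C →[ p ] D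

module Reduction (_≺_ : Rel (Tm basis) 0ℓ) where

  open Equational _≺_ public

  SemiValue : Config → Set
  SemiValue C = QValue (state C)

  infix 3 _⇝[_]_
  _⇝[_]_ : Config → ℝ → Config → Set
  C ⇝[ p ] C′ = SemiValue C × SemiValue C′ ×
    Σ[ t ∈ Tm term ] Σ[ t′ ∈ Tm term ] Σ[ Q ∈ QType ] Σ[ Q′ ∈ QType ]
      ([] ⊢ state C ≈ t ∶ Q) ×
      (record C { state = t } →[ p ] record C′ { state = t′ }) ×
      ([] ⊢ t′ ≈ state C′ ∶ Q′)

{-# OPTIONS --safe #-}
module Submission where

-- The quantum data play no role in termination: a reduction of configurations
-- is simulated by a reduction of main-calculus terms in which measuring may
-- return any classical value whatsoever.  Replacing every free variable of the
-- body by one and the same variable makes the simulation insensitive to the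
-- renaming of variables, to the permutation and to the blocks being created,
-- merged, divided and consumed.  Each step of a configuration becomes exactly
-- one step of collapsed bodies (simulate), so it suffices that the collapsed
-- body of a well-formed configuration has no infinite reduction.
--
-- That is proved by Tait's method of computability.  A term is computable at a
-- type when it is strongly normalising and its normal forms that are values
-- belong to the interpretation of the type.  The interpretation constrains
-- only values of the expected shape.  Hence every classical value is in the
-- interpretation of every type of the form classicalType Q
-- (classical-computable), and neither the typing of states nor its
-- preservation is needed.  Linearity is irrelevant as well: in the
-- fundamental lemma a context only serves to look up the types of variables.

open import Defs
open import Level using (0ℓ)
open import Data.Empty using (⊥-elim)
open import Data.Fin.Base as Fin using (Fin; zero; suc; _↑ˡ_; _↑ʳ_)
open import Data.Maybe.Base using (just)
open import Data.Nat.Base using (ℕ; zero; suc)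
open import Data.Product.Base using (Σ-syntax; _×_; _,_; proj₁; proj₂)
open import Data.Unit.Base using (⊤; tt)
import Data.Vec.Base as Vec
open import Data.Vec.Properties using (lookup-map)
open import Relation.Binary.Construct.Closure.Equivalence using (gfold)
open import Relation.Binary.Core using (Rel)
open import Relation.Binary.Structures using (IsStrictTotalOrder)
open import Relation.Binary.PropositionalEquality
  using (_≡_; refl; sym; trans; cong; cong₂; subst; subst₂; isEquivalence)
open import Relation.Nullary.Negation using (¬_)

private
  variable
    m n k : ℕ

-- Renaming and substitution

cong₃ : ∀ {A B C D : Set} (f : A → B → C → D) {a a′ b b′ c c′} →
        a ≡ a′ → b ≡ b′ → c ≡ c′ → f a b c ≡ f a′ b′ c′
cong₃ f refl refl refl = refl

-- The composition laws below take the composite as a separate argument,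
-- constrained pointwise, so that no function extensionality is needed when
-- passing under a binder.

lift₁-∘ : {ρ : Fin n → Fin k} {π : Fin m → Fin n} {χ : Fin m → Fin k} →
          (∀ x → ρ (π x) ≡ χ x) → ∀ x → Fin.lift 1 ρ (Fin.lift 1 π x) ≡ Fin.lift 1 χ x
lift₁-∘ h zero    = refl
lift₁-∘ h (suc x) = cong suc (h x)

lift₂-∘ : {ρ : Fin n → Fin k} {π : Fin m → Fin n} {χ : Fin m → Fin k} →
          (∀ x → ρ (π x) ≡ χ x) → ∀ x → Fin.lift 2 ρ (Fin.lift 2 π x) ≡ Fin.lift 2 χ x
lift₂-∘ h zero    = refl
lift₂-∘ h (suc x) = cong suc (lift₁-∘ h x)

ren-ren : {ρ : Fin n → Fin k} {π : Fin m → Fin n} {χ : Fin m → Fin k} →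
          (∀ x → ρ (π x) ≡ χ x) → ∀ M → ren ρ (ren π M) ≡ ren χ M
ren-ren h ⋆             = refl
ren-ren h (var x)       = cong var (h x)
ren-ren h (inl M)       = cong inl (ren-ren h M)
ren-ren h (inr M)       = cong inr (ren-ren h M)
ren-ren h (case L M N)  = cong₃ case (ren-ren h L) (ren-ren (lift₁-∘ h) M) (ren-ren (lift₁-∘ h) N)
ren-ren h (M ⊗ N)       = cong₂ _⊗_ (ren-ren h M) (ren-ren h N)
ren-ren h (let⊗ M N)    = cong₂ let⊗ (ren-ren h M) (ren-ren (lift₂-∘ h) N)
ren-ren h (lift M)      = cong lift (ren-ren h M)
ren-ren h (force M)     = cong force (ren-ren h M)
ren-ren h (ƛ M)         = cong ƛ (ren-ren (lift₁-∘ h) M)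
ren-ren h (M ∙ N)       = cong₂ _∙_ (ren-ren h M) (ren-ren h N)
ren-ren h zero          = refl
ren-ren h (succ M)      = cong succ (ren-ren h M)
ren-ren h (match L M N) = cong₃ match (ren-ren h L) (ren-ren h M) (ren-ren (lift₁-∘ h) N)
ren-ren h (pure t)      = refl
ren-ren h (meas M)      = cong meas (ren-ren h M)
ren-ren h (apply u M)   = cong (apply u) (ren-ren h M)
ren-ren h (let𝓑 M N)    = cong₂ let𝓑 (ren-ren h M) (ren-ren (lift₁-∘ h) N)
ren-ren h (let𝓑⊗ M N)   = cong₂ let𝓑⊗ (ren-ren h M) (ren-ren (lift₂-∘ h) N)

exts-lift₁ : {σ : Fin n → Term k} {ρ : Fin m → Fin n} {τ : Fin m → Term k} →
             (∀ x → σ (ρ x) ≡ τ x) → ∀ x → exts σ (Fin.lift 1 ρ x) ≡ exts τ x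
exts-lift₁ h zero    = refl
exts-lift₁ h (suc x) = cong (ren suc) (h x)

exts-lift₂ : {σ : Fin n → Term k} {ρ : Fin m → Fin n} {τ : Fin m → Term k} →
             (∀ x → σ (ρ x) ≡ τ x) → ∀ x → exts (exts σ) (Fin.lift 2 ρ x) ≡ exts (exts τ) x
exts-lift₂ h zero    = refl
exts-lift₂ h (suc x) = cong (ren suc) (exts-lift₁ h x)

sub-ren : {σ : Fin n → Term k} {ρ : Fin m → Fin n} {τ : Fin m → Term k} →
          (∀ x → σ (ρ x) ≡ τ x) → ∀ M → sub σ (ren ρ M) ≡ sub τ M
sub-ren h ⋆             = refl
sub-ren h (var x)       = h x
sub-ren h (inl M)       = cong inl (sub-ren h M)
sub-ren h (inr M)       = cong inr (sub-ren h M)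
sub-ren h (case L M N)  = cong₃ case (sub-ren h L) (sub-ren (exts-lift₁ h) M) (sub-ren (exts-lift₁ h) N)
sub-ren h (M ⊗ N)       = cong₂ _⊗_ (sub-ren h M) (sub-ren h N)
sub-ren h (let⊗ M N)    = cong₂ let⊗ (sub-ren h M) (sub-ren (exts-lift₂ h) N)
sub-ren h (lift M)      = cong lift (sub-ren h M)
sub-ren h (force M)     = cong force (sub-ren h M)
sub-ren h (ƛ M)         = cong ƛ (sub-ren (exts-lift₁ h) M)
sub-ren h (M ∙ N)       = cong₂ _∙_ (sub-ren h M) (sub-ren h N)
sub-ren h zero          = refl
sub-ren h (succ M)      = cong succ (sub-ren h M)
sub-ren h (match L M N) = cong₃ match (sub-ren h L) (sub-ren h M) (sub-ren (exts-lift₁ h) N)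
sub-ren h (pure t)      = refl
sub-ren h (meas M)      = cong meas (sub-ren h M)
sub-ren h (apply u M)   = cong (apply u) (sub-ren h M)
sub-ren h (let𝓑 M N)    = cong₂ let𝓑 (sub-ren h M) (sub-ren (exts-lift₁ h) N)
sub-ren h (let𝓑⊗ M N)   = cong₂ let𝓑⊗ (sub-ren h M) (sub-ren (exts-lift₂ h) N)

ren-lift₁-suc : (ρ : Fin m → Fin n) (M : Term m) →
                ren (Fin.lift 1 ρ) (ren suc M) ≡ ren suc (ren ρ M)
ren-lift₁-suc ρ M =
  trans (ren-ren {χ = λ x → suc (ρ x)} (λ _ → refl) M) (sym (ren-ren (λ _ → refl) M))

ren-lift₂-suc : (ρ : Fin m → Fin n) (M : Term (suc m)) →
                ren (Fin.lift 2 ρ) (ren suc M) ≡ ren suc (ren (Fin.lift 1 ρ) M)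
ren-lift₂-suc ρ M =
  trans (ren-ren {χ = λ x → suc (Fin.lift 1 ρ x)} (λ _ → refl) M) (sym (ren-ren (λ _ → refl) M))

lift₁-exts : {ρ : Fin n → Fin k} {σ : Fin m → Term n} {τ : Fin m → Term k} →
             (∀ x → ren ρ (σ x) ≡ τ x) → ∀ x → ren (Fin.lift 1 ρ) (exts σ x) ≡ exts τ x
lift₁-exts             h zero    = refl
lift₁-exts {ρ = ρ} {σ} h (suc x) = trans (ren-lift₁-suc ρ (σ x)) (cong (ren suc) (h x))

lift₂-exts : {ρ : Fin n → Fin k} {σ : Fin m → Term n} {τ : Fin m → Term k} →
             (∀ x → ren ρ (σ x) ≡ τ x) →
             ∀ x → ren (Fin.lift 2 ρ) (exts (exts σ) x) ≡ exts (exts τ) x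
lift₂-exts             h zero    = refl
lift₂-exts {ρ = ρ} {σ} h (suc x) =
  trans (ren-lift₂-suc ρ (exts σ x)) (cong (ren suc) (lift₁-exts h x))

ren-sub : {ρ : Fin n → Fin k} {σ : Fin m → Term n} {τ : Fin m → Term k} →
          (∀ x → ren ρ (σ x) ≡ τ x) → ∀ M → ren ρ (sub σ M) ≡ sub τ M
ren-sub h ⋆             = refl
ren-sub h (var x)       = h x
ren-sub h (inl M)       = cong inl (ren-sub h M)
ren-sub h (inr M)       = cong inr (ren-sub h M)
ren-sub h (case L M N)  = cong₃ case (ren-sub h L) (ren-sub (lift₁-exts h) M) (ren-sub (lift₁-exts h) N)
ren-sub h (M ⊗ N)       = cong₂ _⊗_ (ren-sub h M) (ren-sub h N)
ren-sub h (let⊗ M N)    = cong₂ let⊗ (ren-sub h M) (ren-sub (lift₂-exts h) N)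
ren-sub h (lift M)      = cong lift (ren-sub h M)
ren-sub h (force M)     = cong force (ren-sub h M)
ren-sub h (ƛ M)         = cong ƛ (ren-sub (lift₁-exts h) M)
ren-sub h (M ∙ N)       = cong₂ _∙_ (ren-sub h M) (ren-sub h N)
ren-sub h zero          = refl
ren-sub h (succ M)      = cong succ (ren-sub h M)
ren-sub h (match L M N) = cong₃ match (ren-sub h L) (ren-sub h M) (ren-sub (lift₁-exts h) N)
ren-sub h (pure t)      = refl
ren-sub h (meas M)      = cong meas (ren-sub h M)
ren-sub h (apply u M)   = cong (apply u) (ren-sub h M)
ren-sub h (let𝓑 M N)    = cong₂ let𝓑 (ren-sub h M) (ren-sub (lift₁-exts h) N)
ren-sub h (let𝓑⊗ M N)   = cong₂ let𝓑⊗ (ren-sub h M) (ren-sub (lift₂-exts h) N)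

exts-∘ : {σ : Fin n → Term k} {υ : Fin m → Term n} {τ : Fin m → Term k} →
         (∀ x → sub σ (υ x) ≡ τ x) → ∀ x → sub (exts σ) (exts υ x) ≡ exts τ x
exts-∘             h zero    = refl
exts-∘ {σ = σ} {υ} h (suc x) =
  trans (sub-ren {τ = λ y → ren suc (σ y)} (λ _ → refl) (υ x))
  (trans (sym (ren-sub (λ _ → refl) (υ x))) (cong (ren suc) (h x)))

sub-sub : {σ : Fin n → Term k} {υ : Fin m → Term n} {τ : Fin m → Term k} →
          (∀ x → sub σ (υ x) ≡ τ x) → ∀ M → sub σ (sub υ M) ≡ sub τ M
sub-sub h ⋆             = refl
sub-sub h (var x)       = h x
sub-sub h (inl M)       = cong inl (sub-sub h M)
sub-sub h (inr M)       = cong inr (sub-sub h M)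
sub-sub h (case L M N)  = cong₃ case (sub-sub h L) (sub-sub (exts-∘ h) M) (sub-sub (exts-∘ h) N)
sub-sub h (M ⊗ N)       = cong₂ _⊗_ (sub-sub h M) (sub-sub h N)
sub-sub h (let⊗ M N)    = cong₂ let⊗ (sub-sub h M) (sub-sub (exts-∘ (exts-∘ h)) N)
sub-sub h (lift M)      = cong lift (sub-sub h M)
sub-sub h (force M)     = cong force (sub-sub h M)
sub-sub h (ƛ M)         = cong ƛ (sub-sub (exts-∘ h) M)
sub-sub h (M ∙ N)       = cong₂ _∙_ (sub-sub h M) (sub-sub h N)
sub-sub h zero          = refl
sub-sub h (succ M)      = cong succ (sub-sub h M)
sub-sub h (match L M N) = cong₃ match (sub-sub h L) (sub-sub h M) (sub-sub (exts-∘ h) N)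
sub-sub h (pure t)      = refl
sub-sub h (meas M)      = cong meas (sub-sub h M)
sub-sub h (apply u M)   = cong (apply u) (sub-sub h M)
sub-sub h (let𝓑 M N)    = cong₂ let𝓑 (sub-sub h M) (sub-sub (exts-∘ h) N)
sub-sub h (let𝓑⊗ M N)   = cong₂ let𝓑⊗ (sub-sub h M) (sub-sub (exts-∘ (exts-∘ h)) N)

exts-var : {σ : Fin n → Term n} → (∀ x → σ x ≡ var x) → ∀ x → exts σ x ≡ var x
exts-var h zero    = refl
exts-var h (suc x) = cong (ren suc) (h x)

sub-var : {σ : Fin n → Term n} → (∀ x → σ x ≡ var x) → ∀ M → sub σ M ≡ M
sub-var h ⋆             = refl
sub-var h (var x)       = h x
sub-var h (inl M)       = cong inl (sub-var h M)
sub-var h (inr M)       = cong inr (sub-var h M)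
sub-var h (case L M N)  = cong₃ case (sub-var h L) (sub-var (exts-var h) M) (sub-var (exts-var h) N)
sub-var h (M ⊗ N)       = cong₂ _⊗_ (sub-var h M) (sub-var h N)
sub-var h (let⊗ M N)    = cong₂ let⊗ (sub-var h M) (sub-var (exts-var (exts-var h)) N)
sub-var h (lift M)      = cong lift (sub-var h M)
sub-var h (force M)     = cong force (sub-var h M)
sub-var h (ƛ M)         = cong ƛ (sub-var (exts-var h) M)
sub-var h (M ∙ N)       = cong₂ _∙_ (sub-var h M) (sub-var h N)
sub-var h zero          = refl
sub-var h (succ M)      = cong succ (sub-var h M)
sub-var h (match L M N) = cong₃ match (sub-var h L) (sub-var h M) (sub-var (exts-var h) N)
sub-var h (pure t)      = refl
sub-var h (meas M)      = cong meas (sub-var h M)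
sub-var h (apply u M)   = cong (apply u) (sub-var h M)
sub-var h (let𝓑 M N)    = cong₂ let𝓑 (sub-var h M) (sub-var (exts-var h) N)
sub-var h (let𝓑⊗ M N)   = cong₂ let𝓑⊗ (sub-var h M) (sub-var (exts-var (exts-var h)) N)

-- Extension of a substitution by a term for one more variable, of index 0.
infixr 5 _◂_
_◂_ : Term n → (Fin m → Term n) → Fin (suc m) → Term n
(V ◂ σ) zero    = V
(V ◂ σ) (suc x) = σ x

exts-instantiate : (σ : Fin m → Term n) (V : Term n) (M : Term (suc m)) →
                   sub (exts σ) M [ V ] ≡ sub (V ◂ σ) M
exts-instantiate σ V M = sub-sub (λ
  { zero    → refl
  ; (suc x) → trans (sub-ren {τ = var} (λ _ → refl) (σ x)) (sub-var (λ _ → refl) (σ x)) }) M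

exts²-instantiate : (σ : Fin m → Term n) (V W : Term n) (M : Term (suc (suc m))) →
                    sub (exts (exts σ)) M [ V ∥ W ] ≡ sub (V ◂ W ◂ σ) M
exts²-instantiate σ V W M = sub-sub (λ
  { zero          → refl
  ; (suc zero)    → refl
  ; (suc (suc x)) →
      trans (sub-ren {τ = W ◂ var} (λ { zero → refl ; (suc _) → refl }) (ren suc (σ x)))
      (trans (sub-ren {τ = var} (λ _ → refl) (σ x)) (sub-var (λ _ → refl) (σ x))) }) M

sub-[] : (σ : Fin m → Term n) (M : Term (suc m)) (V : Term m) →
         sub (exts σ) M [ sub σ V ] ≡ sub σ (M [ V ])
sub-[] σ M V = trans (exts-instantiate σ (sub σ V) M)
  (sym (sub-sub (λ { zero → refl ; (suc x) → refl }) M))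

sub-[∥] : (σ : Fin m → Term n) (M : Term (suc (suc m))) (V W : Term m) →
          sub (exts (exts σ)) M [ sub σ V ∥ sub σ W ] ≡ sub σ (M [ V ∥ W ])
sub-[∥] σ M V W = trans (exts²-instantiate σ (sub σ V) (sub σ W) M)
  (sym (sub-sub (λ { zero → refl ; (suc zero) → refl ; (suc (suc x)) → refl }) M))

sub-value : {σ : Fin m → Term n} → (∀ x → Value (σ x)) → ∀ {V} → Value V → Value (sub σ V)
sub-value h ⋆        = ⋆
sub-value h (var x)  = h x
sub-value h (inl v)  = inl (sub-value h v)
sub-value h (inr v)  = inr (sub-value h v)
sub-value h (v ⊗ w)  = sub-value h v ⊗ sub-value h w
sub-value h (lift M) = lift _
sub-value h (ƛ M)    = ƛ _
sub-value h zero     = zero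
sub-value h (succ v) = succ (sub-value h v)

-- Reduction of collapsed terms

-- Terms over a single free variable, which stands for all quantum data at
-- once.  A measurement yields an arbitrary classical value, with no reference
-- to a state, and the variables bound by let𝓑 and let𝓑⊗ are replaced by the
-- single free variable.
infix 4 _⟶_
data _⟶_ : Term 1 → Term 1 → Set where
  β-case-inl   : ∀ {V M N} → Value V → case (inl V) M N ⟶ M [ V ]
  β-case-inr   : ∀ {V M N} → Value V → case (inr V) M N ⟶ N [ V ]
  β-let⊗       : ∀ {V W M} → Value V → Value W → let⊗ (V ⊗ W) M ⟶ M [ V ∥ W ]
  β-force      : ∀ {M} → force (lift M) ⟶ M
  β-ƛ          : ∀ {M V} → Value V → ƛ M ∙ V ⟶ M [ V ]
  β-match-zero : ∀ {M N} → match zero M N ⟶ M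
  β-match-succ : ∀ {V M N} → Value V → match (succ V) M N ⟶ N [ V ]
  β-pure       : ∀ {t} → pure t ⟶ var zero
  β-meas       : ∀ {b V} → Classical b V → meas (var zero) ⟶ V
  β-apply      : ∀ {u} → apply u (var zero) ⟶ var zero
  β-let𝓑       : ∀ {N} → let𝓑 (var zero ⊗ var zero) N ⟶ N [ var zero ]
  β-let𝓑⊗      : ∀ {N} → let𝓑⊗ (var zero) N ⟶ N [ var zero ∥ var zero ]

  ξ-⊗ˡ    : ∀ {M M′ N} → M ⟶ M′ → M ⊗ N ⟶ M′ ⊗ N
  ξ-⊗ʳ    : ∀ {V N N′} → Value V → N ⟶ N′ → V ⊗ N ⟶ V ⊗ N′
  ξ-let⊗  : ∀ {M M′ N} → M ⟶ M′ → let⊗ M N ⟶ let⊗ M′ N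
  ξ-inl   : ∀ {M M′} → M ⟶ M′ → inl M ⟶ inl M′
  ξ-inr   : ∀ {M M′} → M ⟶ M′ → inr M ⟶ inr M′
  ξ-case  : ∀ {L L′ M N} → L ⟶ L′ → case L M N ⟶ case L′ M N
  ξ-force : ∀ {M M′} → M ⟶ M′ → force M ⟶ force M′
  ξ-succ  : ∀ {M M′} → M ⟶ M′ → succ M ⟶ succ M′
  ξ-match : ∀ {L L′ M N} → L ⟶ L′ → match L M N ⟶ match L′ M N
  ξ-∙ˡ    : ∀ {M M′ N} → M ⟶ M′ → M ∙ N ⟶ M′ ∙ N
  ξ-∙ʳ    : ∀ {V N N′} → Value V → N ⟶ N′ → V ∙ N ⟶ V ∙ N′
  ξ-meas  : ∀ {M M′} → M ⟶ M′ → meas M ⟶ meas M′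
  ξ-apply : ∀ {u M M′} → M ⟶ M′ → apply u M ⟶ apply u M′
  ξ-let𝓑  : ∀ {M M′ N} → M ⟶ M′ → let𝓑 M N ⟶ let𝓑 M′ N
  ξ-let𝓑⊗ : ∀ {M M′ N} → M ⟶ M′ → let𝓑⊗ M N ⟶ let𝓑⊗ M′ N

value-irreducible : ∀ {V M} → Value V → ¬ (V ⟶ M)
value-irreducible (inl v)  (ξ-inl s)    = value-irreducible v s
value-irreducible (inr v)  (ξ-inr s)    = value-irreducible v s
value-irreducible (v ⊗ w)  (ξ-⊗ˡ s)     = value-irreducible v s
value-irreducible (v ⊗ w)  (ξ-⊗ʳ _ s)   = value-irreducible w s
value-irreducible (succ v) (ξ-succ s)   = value-irreducible v s

-- Simulation of configurations by collapsed terms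

collapseσ : Fin n → Term 1
collapseσ _ = var zero

-- The term with all its free variables identified.
collapse : Term n → Term 1
collapse = sub collapseσ

collapse-ren : (ρ : Fin m → Fin n) (M : Term m) → collapse (ren ρ M) ≡ collapse M
collapse-ren ρ = sub-ren λ _ → refl

collapse₁-ren : (ρ : Fin m → Fin n) (M : Term (suc m)) →
                sub (exts collapseσ) (ren (Fin.lift 1 ρ) M) ≡ sub (exts collapseσ) M
collapse₁-ren ρ = sub-ren (exts-lift₁ λ _ → refl)

collapse₂-ren : (ρ : Fin m → Fin n) (M : Term (suc (suc m))) →
                sub (exts (exts collapseσ)) (ren (Fin.lift 2 ρ) M) ≡ sub (exts (exts collapseσ)) M
collapse₂-ren ρ = sub-ren (exts-lift₂ λ _ → refl)

collapse-value : {V : Term n} → Value V → Value (collapse V)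
collapse-value = sub-value λ _ → var zero

collapse-classical : ∀ {b} {V : Term n} → Classical b V → Classical b (collapse V)
collapse-classical ⋆       = ⋆
collapse-classical (v ⊗ w) = collapse-classical v ⊗ collapse-classical w
collapse-classical (inl v) = inl (collapse-classical v)
collapse-classical (inr v) = inr (collapse-classical v)
collapse-classical zero    = zero
collapse-classical (S v)   = S (collapse-classical v)

-- The two sides may have different numbers of free variables, as a step can
-- create or consume quantum data.
plug-step : (ρ : Fin k → Fin m) (π : Fin k → Fin n) (E : ECtx k) {M : Term m} {M′ : Term n} →
            collapse M ⟶ collapse M′ → collapse (plug (renᴱ ρ E) M) ⟶ collapse (plug (renᴱ π E) M′)
plug-step ρ π hole s = s
plug-step ρ π (E ⊗ˡ N) s rewrite collapse-ren ρ N | collapse-ren π N = ξ-⊗ˡ (plug-step ρ π E s)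
plug-step ρ π (_⊗ʳ_ {V = V} v E) s rewrite collapse-ren ρ V | collapse-ren π V =
  ξ-⊗ʳ (collapse-value v) (plug-step ρ π E s)
plug-step ρ π (let⊗ E N) s rewrite collapse₂-ren ρ N | collapse₂-ren π N =
  ξ-let⊗ (plug-step ρ π E s)
plug-step ρ π (inl E) s = ξ-inl (plug-step ρ π E s)
plug-step ρ π (inr E) s = ξ-inr (plug-step ρ π E s)
plug-step ρ π (case E N₁ N₂) s
  rewrite collapse₁-ren ρ N₁ | collapse₁-ren π N₁ | collapse₁-ren ρ N₂ | collapse₁-ren π N₂ =
  ξ-case (plug-step ρ π E s)
plug-step ρ π (force E) s = ξ-force (plug-step ρ π E s)
plug-step ρ π (succ E) s = ξ-succ (plug-step ρ π E s)
plug-step ρ π (match E N₁ N₂) s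
  rewrite collapse-ren ρ N₁ | collapse-ren π N₁ | collapse₁-ren ρ N₂ | collapse₁-ren π N₂ =
  ξ-match (plug-step ρ π E s)
plug-step ρ π (E ∙ˡ N) s rewrite collapse-ren ρ N | collapse-ren π N = ξ-∙ˡ (plug-step ρ π E s)
plug-step ρ π (_∙ʳ_ {V = V} v E) s rewrite collapse-ren ρ V | collapse-ren π V =
  ξ-∙ʳ (collapse-value v) (plug-step ρ π E s)
plug-step ρ π (meas E) s = ξ-meas (plug-step ρ π E s)
plug-step ρ π (apply u E) s = ξ-apply (plug-step ρ π E s)
plug-step ρ π (let𝓑 E N) s rewrite collapse₁-ren ρ N | collapse₁-ren π N =
  ξ-let𝓑 (plug-step ρ π E s)
plug-step ρ π (let𝓑⊗ E N) s rewrite collapse₂-ren ρ N | collapse₂-ren π N =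
  ξ-let𝓑⊗ (plug-step ρ π E s)

reduct-≡ : ∀ {M N N′} → N ≡ N′ → M ⟶ N → M ⟶ N′
reduct-≡ refl s = s

collapse-∼ : ∀ {C D} → C ∼ D → collapse (body C) ≡ collapse (body D)
collapse-∼ (perm-≈ _)         = refl
collapse-∼ (rename {M = M} π) = sym (collapse-ren (reindex π) M)

collapse-≅ : ∀ {C D} → C ≅ D → collapse (body C) ≡ collapse (body D)
collapse-≅ = gfold isEquivalence (λ C → collapse (body C)) collapse-∼

simulate : ∀ {C p D} → C →[ p ] D → collapse (body C) ⟶ collapse (body D)
simulate (case-inl {V = V} {M} v) =
  reduct-≡ (sub-[] collapseσ M V) (β-case-inl (collapse-value v))
simulate (case-inr {V = V} {N = N} v) =
  reduct-≡ (sub-[] collapseσ N V) (β-case-inr (collapse-value v))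
simulate (let⊗ {V = V} {W} {M} v w) =
  reduct-≡ (sub-[∥] collapseσ M V W) (β-let⊗ (collapse-value v) (collapse-value w))
simulate force = β-force
simulate (beta {M = M} {V} v) =
  reduct-≡ (sub-[] collapseσ M V) (β-ƛ (collapse-value v))
simulate match-zero = β-match-zero
simulate (match-succ {V = V} {N = N} v) =
  reduct-≡ (sub-[] collapseσ N V) (β-match-succ (collapse-value v))
simulate (pure _) = β-pure
simulate (meas s w p m α b b′ _ _ k c) = β-meas (collapse-classical c)
simulate (apply _ _) = β-apply
-- Instantiating the bound variables with the single free variable is the same
-- as collapsing them together with the free ones.
simulate (let𝓑 {N = N}) = reduct-≡
  (trans (cong _[ var zero ] (collapse₁-ren (2 ↑ʳ_) N))
    (sub-sub (λ { zero → refl ; (suc _) → refl }) N))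
  β-let𝓑
simulate (let𝓑⊗ {N = N}) = reduct-≡
  (trans (cong _[ var zero ∥ var zero ] (collapse₂-ren suc N))
    (sub-sub (λ { zero → refl ; (suc zero) → refl ; (suc (suc _)) → refl }) N))
  β-let𝓑⊗
simulate (context {k₁} {k₂} {l} {M₁ = M₁} {M₂} E τ r) =
  plug-step (k₁ ↑ʳ_) (k₂ ↑ʳ_) E
    (subst₂ _⟶_ (sym (collapse-ren (_↑ˡ l) M₁)) (sym (collapse-ren (_↑ˡ l) M₂)) (simulate r))
simulate (up-to C≅C′ r D′≅D) =
  subst₂ _⟶_ (sym (collapse-≅ C≅C′)) (collapse-≅ D′≅D) (simulate r)

-- Computability

-- The strongly normalising terms all of whose reducts that are values satisfy P.
data Computes (P : Term 1 → Set) (M : Term 1) : Set where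
  computes : (∀ {M′} → M ⟶ M′ → Computes P M′) → (Value M → P M) → Computes P M

-- The interpretation of a type, as a predicate on values.  A value not of the
-- shape that the type calls for satisfies it vacuously; at I, Nat and 𝓑 Q
-- there is no constraint at all, because matching a number exposes a value that
-- is again at Nat, and a measurement yields a computable value whatever was
-- measured.
ValueAt : Type → Term 1 → Set
ValueAt I       _ = ⊤
ValueAt (A ⊞ B) W = (∀ {V} → W ≡ inl V → Computes (ValueAt A) V) ×
                    (∀ {V} → W ≡ inr V → Computes (ValueAt B) V)
ValueAt (A ⊗ B) W = ∀ {V V′} → W ≡ V ⊗ V′ → Computes (ValueAt A) V × Computes (ValueAt B) V′
ValueAt (! A)   W = ∀ {M} → W ≡ lift M → Computes (ValueAt A) M
ValueAt (A ⊸ B) W = ∀ {M V} → W ≡ ƛ M → Value V → Computes (ValueAt A) V →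
                    Computes (ValueAt B) (M [ V ])
ValueAt Nat     _ = ⊤
ValueAt (𝓑 Q)   _ = ⊤

infix 3 _⊨_
_⊨_ : Type → Term 1 → Set
A ⊨ M = Computes (ValueAt A) M

value-computes : ∀ {P V} → Value V → P V → Computes P V
value-computes v p = computes (λ s → ⊥-elim (value-irreducible v s)) (λ _ → p)

classical-value : ∀ {b} {V : Term n} → Classical b V → Value V
classical-value ⋆       = ⋆
classical-value (v ⊗ w) = classical-value v ⊗ classical-value w
classical-value (inl v) = inl (classical-value v)
classical-value (inr v) = inr (classical-value v)
classical-value zero    = zero
classical-value (S v)   = succ (classical-value v)

-- The classical value need not come from a basis value of type Q.
mutual
  classical-valueAt : ∀ Q {b V} → Classical b V → ValueAt (classicalType Q) V
  classical-valueAt I         c = tt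
  classical-valueAt (Q₁ ⊕ Q₂) c =
    (λ { refl → inl-case c }) , (λ { refl → inr-case c })
    where
    inl-case : ∀ {b V} → Classical b (inl V) → classicalType Q₁ ⊨ V
    inl-case (inl c) = classical-computable Q₁ c
    inr-case : ∀ {b V} → Classical b (inr V) → classicalType Q₂ ⊨ V
    inr-case (inr c) = classical-computable Q₂ c
  classical-valueAt (Q₁ ⊗ Q₂) c refl = pair c
    where
    pair : ∀ {b V W} → Classical b (V ⊗ W) → (classicalType Q₁ ⊨ V) × (classicalType Q₂ ⊨ W)
    pair (c ⊗ d) = classical-computable Q₁ c , classical-computable Q₂ d
  classical-valueAt qnat      c = tt

  classical-computable : ∀ Q {b V} → Classical b V → classicalType Q ⊨ V
  classical-computable Q c = value-computes (classical-value c) (classical-valueAt Q c)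

-- Each term former preserves computability.

⊨-inl : ∀ {A B M} → A ⊨ M → A ⊞ B ⊨ inl M
⊨-inl {A} {B} a@(computes f _) = computes
  (λ { (ξ-inl s) → ⊨-inl {A} {B} (f s) })
  (λ _ → (λ { refl → a }) , (λ ()))

⊨-inr : ∀ {A B M} → B ⊨ M → A ⊞ B ⊨ inr M
⊨-inr {A} {B} b@(computes f _) = computes
  (λ { (ξ-inr s) → ⊨-inr {A} {B} (f s) })
  (λ _ → (λ ()) , (λ { refl → b }))

⊨-case : ∀ {A B C L M N} → A ⊞ B ⊨ L →
         (∀ {V} → A ⊨ V → C ⊨ M [ V ]) → (∀ {V} → B ⊨ V → C ⊨ N [ V ]) →
         C ⊨ case L M N
⊨-case {A} {B} {C} (computes f p) g h = computes
  (λ { (ξ-case s)     → ⊨-case {A} {B} {C} (f s) g h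
     ; (β-case-inl v) → g (proj₁ (p (inl v)) refl)
     ; (β-case-inr v) → h (proj₂ (p (inr v)) refl) })
  (λ ())

-- By lexicographic induction on the computability of the two components.
mutual
  ⊨-⊗ : ∀ {A B M N} → A ⊨ M → B ⊨ N → A ⊗ B ⊨ M ⊗ N
  ⊨-⊗ {A} {B} a b = computes (⊨-⊗-step {A} {B} a b) (λ { _ refl → a , b })

  ⊨-⊗-step : ∀ {A B M N L} → A ⊨ M → B ⊨ N → M ⊗ N ⟶ L → A ⊗ B ⊨ L
  ⊨-⊗-step {A} {B} (computes f _) b (ξ-⊗ˡ s)   = ⊨-⊗ {A} {B} (f s) b
  ⊨-⊗-step {A} {B} a (computes g _) (ξ-⊗ʳ _ s) = ⊨-⊗ {A} {B} a (g s)

⊨-let⊗ : ∀ {A B C M N} → A ⊗ B ⊨ M → (∀ {V W} → A ⊨ V → B ⊨ W → C ⊨ N [ V ∥ W ]) →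
         C ⊨ let⊗ M N
⊨-let⊗ {A} {B} {C} (computes f p) g = computes
  (λ { (ξ-let⊗ s)   → ⊨-let⊗ {A} {B} {C} (f s) g
     ; (β-let⊗ v w) → g (proj₁ (p (v ⊗ w) refl)) (proj₂ (p (v ⊗ w) refl)) })
  (λ ())

⊨-lift : ∀ {A M} → A ⊨ M → ! A ⊨ lift M
⊨-lift a = value-computes (lift _) λ { refl → a }

⊨-force : ∀ {A M} → ! A ⊨ M → A ⊨ force M
⊨-force {A} (computes f p) = computes
  (λ { (ξ-force s) → ⊨-force {A} (f s)
     ; β-force     → p (lift _) refl })
  (λ ())

⊨-ƛ : ∀ {A B M} → (∀ {V} → A ⊨ V → B ⊨ M [ V ]) → A ⊸ B ⊨ ƛ M
⊨-ƛ g = value-computes (ƛ _) λ { refl _ → g }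

mutual
  ⊨-∙ : ∀ {A B M N} → A ⊸ B ⊨ M → A ⊨ N → B ⊨ M ∙ N
  ⊨-∙ {A} {B} a b = computes (⊨-∙-step {A} {B} a b) (λ ())

  ⊨-∙-step : ∀ {A B M N L} → A ⊸ B ⊨ M → A ⊨ N → M ∙ N ⟶ L → B ⊨ L
  ⊨-∙-step {A} {B} (computes f _) b (ξ-∙ˡ s)   = ⊨-∙ {A} {B} (f s) b
  ⊨-∙-step {A} {B} a (computes g _) (ξ-∙ʳ _ s) = ⊨-∙ {A} {B} a (g s)
  ⊨-∙-step {A} {B} (computes _ p) b (β-ƛ v)    = p (ƛ _) refl v b

⊨-succ : ∀ {M} → Nat ⊨ M → Nat ⊨ succ M
⊨-succ (computes f _) = computes (λ { (ξ-succ s) → ⊨-succ (f s) }) _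

⊨-match : ∀ {A L M N} → Nat ⊨ L → A ⊨ M → (∀ {V} → Nat ⊨ V → A ⊨ N [ V ]) → A ⊨ match L M N
⊨-match {A} (computes f _) a g = computes
  (λ { (ξ-match s)      → ⊨-match {A} (f s) a g
     ; β-match-zero     → a
     ; (β-match-succ v) → g (value-computes v tt) })
  (λ ())

⊨-pure : ∀ {Q t} → 𝓑 Q ⊨ pure t
⊨-pure = computes (λ { β-pure → value-computes (var zero) tt }) (λ ())

⊨-meas : ∀ {Q M} → 𝓑 Q ⊨ M → classicalType Q ⊨ meas M
⊨-meas {Q} (computes f _) = computes
  (λ { (ξ-meas s) → ⊨-meas {Q} (f s)
     ; (β-meas c) → classical-computable Q c })
  (λ ())

⊨-apply : ∀ {Q₁ Q₂ u M} → 𝓑 Q₁ ⊨ M → 𝓑 Q₂ ⊨ apply u M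
⊨-apply {Q₁} {Q₂} (computes f _) = computes
  (λ { (ξ-apply s) → ⊨-apply {Q₁} {Q₂} (f s)
     ; β-apply     → value-computes (var zero) tt })
  (λ ())

⊨-let𝓑 : ∀ {Q₁ Q₂ A M N} → 𝓑 Q₁ ⊗ 𝓑 Q₂ ⊨ M → A ⊨ N [ var zero ] → A ⊨ let𝓑 M N
⊨-let𝓑 {Q₁} {Q₂} {A} (computes f _) a = computes
  (λ { (ξ-let𝓑 s) → ⊨-let𝓑 {Q₁} {Q₂} {A} (f s) a
     ; β-let𝓑     → a })
  (λ ())

⊨-let𝓑⊗ : ∀ {Q A M N} → 𝓑 Q ⊨ M → A ⊨ N [ var zero ∥ var zero ] → A ⊨ let𝓑⊗ M N
⊨-let𝓑⊗ {Q} {A} (computes f _) a = computes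
  (λ { (ξ-let𝓑⊗ s) → ⊨-let𝓑⊗ {Q} {A} (f s) a
     ; β-let𝓑⊗     → a })
  (λ ())

-- The fundamental lemma

-- The computable substitutions for a context.
infix 3 _⊨ˢ_
_⊨ˢ_ : Ctx n → (Fin n → Term 1) → Set
Γ ⊨ˢ γ = ∀ x {A} → Vec.lookup Γ x ≡ just A → A ⊨ γ x

split-⊨ˢˡ : ∀ {Γ Γ₁ Γ₂ : Ctx n} {γ} → Split Γ Γ₁ Γ₂ → Γ ⊨ˢ γ → Γ₁ ⊨ˢ γ
split-⊨ˢˡ (shared ∷ _) g zero    eq = g zero eq
split-⊨ˢˡ (left   ∷ _) g zero    eq = g zero eq
split-⊨ˢˡ (_ ∷ sp)     g (suc x) eq = split-⊨ˢˡ sp (λ y → g (suc y)) x eq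

split-⊨ˢʳ : ∀ {Γ Γ₁ Γ₂ : Ctx n} {γ} → Split Γ Γ₁ Γ₂ → Γ ⊨ˢ γ → Γ₂ ⊨ˢ γ
split-⊨ˢʳ (shared ∷ _) g zero    eq = g zero eq
split-⊨ˢʳ (right  ∷ _) g zero    eq = g zero eq
split-⊨ˢʳ (_ ∷ sp)     g (suc x) eq = split-⊨ˢʳ sp (λ y → g (suc y)) x eq

◂-⊨ˢ : ∀ {A V} {Γ : Ctx n} {γ} → A ⊨ V → Γ ⊨ˢ γ → just A Vec.∷ Γ ⊨ˢ V ◂ γ
◂-⊨ˢ a g zero    refl = a
◂-⊨ˢ a g (suc x) eq   = g x eq

mutual
  fundamental : ∀ {Γ : Ctx n} {M A} {γ : Fin n → Term 1} → Γ ⊢ᵐ M ∶ A → Γ ⊨ˢ γ → A ⊨ sub γ M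
  fundamental (⋆ _) g = value-computes ⋆ tt
  fundamental (var x eq _) g = g x eq
  fundamental (inl {A = A} {B} d) g = ⊨-inl {A} {B} (fundamental d g)
  fundamental (inr {A = A} {B} d) g = ⊨-inr {A} {B} (fundamental d g)
  fundamental (case {A = A} {B} {C} sp d e e′) g = ⊨-case {A} {B} {C}
    (fundamental d (split-⊨ˢˡ sp g))
    (fundamental₁ e (split-⊨ˢʳ sp g))
    (fundamental₁ e′ (split-⊨ˢʳ sp g))
  fundamental (tens {A = A} {B} sp d e) g = ⊨-⊗ {A} {B}
    (fundamental d (split-⊨ˢˡ sp g)) (fundamental e (split-⊨ˢʳ sp g))
  fundamental (let⊗ {A = A} {B} {C} sp d e) g = ⊨-let⊗ {A} {B} {C}
    (fundamental d (split-⊨ˢˡ sp g)) (fundamental₂ e (split-⊨ˢʳ sp g))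
  fundamental (lift {A = A} _ d) g = ⊨-lift {A} (fundamental d g)
  fundamental (force {A = A} d) g = ⊨-force {A} (fundamental d g)
  fundamental (ƛ {A = A} {B} d) g = ⊨-ƛ {A} {B} (fundamental₁ d g)
  fundamental (app {A = A} {B} sp d e) g = ⊨-∙ {A} {B}
    (fundamental d (split-⊨ˢˡ sp g)) (fundamental e (split-⊨ˢʳ sp g))
  fundamental (zero _) g = value-computes zero tt
  fundamental (succ d) g = ⊨-succ (fundamental d g)
  fundamental (match {A = A} sp d e e′) g = ⊨-match {A}
    (fundamental d (split-⊨ˢˡ sp g))
    (fundamental e (split-⊨ˢʳ sp g))
    (fundamental₁ e′ (split-⊨ˢʳ sp g))
  fundamental (pure {Q = Q} _ _) g = ⊨-pure {Q}
  fundamental (meas {Q = Q} d) g = ⊨-meas {Q} (fundamental d g)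
  fundamental (apply {Q₁ = Q₁} {Q₂} _ d) g = ⊨-apply {Q₁} {Q₂} (fundamental d g)
  fundamental (let𝓑 {Q₁ = Q₁} {Q₂} {A} sp d e) g = ⊨-let𝓑 {Q₁} {Q₂} {A}
    (fundamental d (split-⊨ˢˡ sp g))
    (fundamental₁ e (split-⊨ˢʳ sp g) (value-computes (var zero) tt))
  fundamental (let𝓑⊗ {Q₁ = Q₁} {Q₂} {A} sp d e) g = ⊨-let𝓑⊗ {Q₁ ⊗ Q₂} {A}
    (fundamental d (split-⊨ˢˡ sp g))
    (fundamental₂ e (split-⊨ˢʳ sp g) (value-computes (var zero) tt) (value-computes (var zero) tt))

  fundamental₁ : ∀ {Γ : Ctx n} {M A B} {γ : Fin n → Term 1} → just A Vec.∷ Γ ⊢ᵐ M ∶ B → Γ ⊨ˢ γ →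
                 ∀ {V} → A ⊨ V → B ⊨ sub (exts γ) M [ V ]
  fundamental₁ {M = M} {A} {B} {γ} d g {V} a =
    subst (B ⊨_) (sym (exts-instantiate γ V M)) (fundamental d (◂-⊨ˢ {A = A} a g))

  fundamental₂ : ∀ {Γ : Ctx n} {M A B C} {γ : Fin n → Term 1} →
                 just A Vec.∷ just B Vec.∷ Γ ⊢ᵐ M ∶ C → Γ ⊨ˢ γ →
                 ∀ {V W} → A ⊨ V → B ⊨ W → C ⊨ sub (exts (exts γ)) M [ V ∥ W ]
  fundamental₂ {M = M} {A} {B} {C} {γ} d g {V} {W} a b =
    subst (C ⊨_) (sym (exts²-instantiate γ V W M))
      (fundamental d (◂-⊨ˢ {A = A} a (◂-⊨ˢ {A = B} b g)))

-- Every free variable of the body has a type 𝓑 Q, at which the variable it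
-- collapses to is computable.
wellFormed-computable : ∀ {C A} → WellFormed C A → A ⊨ collapse (body C)
wellFormed-computable {C} wf = fundamental (WellFormed.body-typed wf) quantum
  where
  quantum : Vec.map (λ Q → just (𝓑 Q)) (blocks C) ⊨ˢ collapseσ
  quantum x eq with trans (sym (lookup-map x (λ Q → just (𝓑 Q)) (blocks C))) eq
  ... | refl = value-computes (var zero) tt

no-infinite-reduction : ∀ {P} (M : ℕ → Term 1) → Computes P (M zero) →
                        ¬ (∀ i → M i ⟶ M (suc i))
no-infinite-reduction M (computes f _) s =
  no-infinite-reduction (λ i → M (suc i)) (f (s zero)) (λ i → s (suc i))

theorem3p29 : (_≺_ : Rel (Tm basis) 0ℓ) → IsStrictTotalOrder _≡_ _≺_ →
    let open Reduction _≺_ in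
    (C : Config) (A : Type) → SemiValue C → WellFormed C A →
    ¬ (Σ[ 𝒞 ∈ (ℕ → Config) ] Σ[ p ∈ (ℕ → ℝ) ]
    (𝒞 zero ≡ C × (∀ i → 𝒞 i ⇝[ p i ] 𝒞 (suc i))))
theorem3p29 _≺_ _ C A _ wf (𝒞 , p , refl , red) =
  no-infinite-reduction (λ i → collapse (body (𝒞 i))) (wellFormed-computable wf) step
  where
  step : ∀ i → collapse (body (𝒞 i)) ⟶ collapse (body (𝒞 (suc i)))
  step i with red i
  ... | _ , _ , _ , _ , _ , _ , _ , r , _ = simulate r
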